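{- Let $d\ge 1$ and let $(f_0, f_1, \ldots, f_{d-1})$ be a finite sequence of integers with $f_i > 0$ for all $i$. Put $f_{ -1}=1$. The following conditions are equivalent: (i) there is a quasi-forest $\Delta$ of dimension $d-1$ with $f(\Delta) = (f_0, \ldots, f_{d-1})$; (ii) there is a forest $\Delta$ of dimension $d-1$ with $f(\Delta) = (f_0, \ldots, f_{d-1})$; (iii) the integers $c_0,\ldots,c_d$ defined by $\sum_{i=0}^{d} f_{i-1}(x-1)^{i} = \sum_{i=0}^{d} c_i x^i$ satisfy $\sum_{i=k}^{d} c_i > 0$ for each $1 \le k \le d$; (iv) the integers $b_1,\ldots,b_d$ defined by $\sum_{i=1}^{d} f_{i-1}(x-1)^{i-1} = \sum_{i=1}^{d} b_i x^{i-1}$ satisfy $b_i > 0$ for all $1 \le i \le d$.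
   Context: A simplicial complex $\Delta$ on $[n]=\{1,\ldots,n\}$ is a collection of subsets of $[n]$ such that $\{i\}\in\Delta$ for every $i\in[n]$ and $G\subset F\in\Delta$ implies $G\in\Delta$. If $d=\max\{|F|:F\in\Delta\}$, then $\dim\Delta=d-1$. Facets are maximal faces. The $f$-vector is $f(\Delta)=(f_0,\ldots,f_{d-1})$, where $f_i$ is the number of faces with $i+1$ elements. For facets $F_{i_1},\ldots,F_{i_q}$, $\langle F_{i_1},\ldots,F_{i_q}\rangle$ denotes the subcomplex consisting of all faces contained in some $F_{i_j}$. A facet $F$ of $\Delta$ is a leaf if there is a facet $G\neq F$ (a branch of $F$) with $H\cap F\subset G\cap F$ for all facets $H\neq F$. A quasi-forest is a simplicial complex whose facets admit an ordering $F_1,\ldots,F_s$ (a leaf order) such that for each $1<j\le s$, $F_j$ is a leaf of $\langle F_1,\ldots,F_j\rangle$. A forest is a simplicial complex such that for every nonempty subset $\{F_{i_1},\ldots,F_{i_q}\}$ of its facets, the subcomplex $\langle F_{i_1},\ldots,F_{i_q}\rangle$ has a leaf. (Here a complex with a single facet is regarded as a quasi-forest and forest, its single facet counting as a leaf.) -}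

module Defs where

open import Data.Fin as Fin using (Fin; toℕ)
open import Data.Fin.Subset using (Subset; inside; outside; _⊆_; _∩_; ∣_∣; ⁅_⁆)
open import Data.Integer as ℤ using (ℤ; +_; 0ℤ; 1ℤ; -1ℤ)
open import Data.List using (List; []; _∷_; [_]; _++_; map; foldr; filter; length; lookup; take; allFin)
open import Data.List.Membership.Propositional using (_∈_)
open import Data.List.Relation.Unary.All using (All)
open import Data.List.Relation.Unary.Any using (Any)
open import Data.List.Relation.Unary.Unique.Propositional using (Unique)
open import Data.Nat as ℕ using (ℕ; zero; suc)
open import Data.Product using (∃-syntax; _×_)
open import Data.Sum using (_⊎_)
open import Data.Vec as Vec using ()
open import Data.Vec.Functional as Vector using (Vector)
open import Function.Bundles using (_⇔_)
open import Level using (0ℓ)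
open import Relation.Binary.PropositionalEquality using (_≡_; _≢_)
open import Relation.Nullary.Decidable using (_×-dec_)
open import Relation.Unary using (Pred; Decidable)

-- Faces are a decidable family of subsets, so that they can be counted.
record SimplicialComplex (n : ℕ) : Set₁ where
  field
    Face       : Pred (Subset n) 0ℓ
    face?      : Decidable Face
    vertex     : ∀ i → Face ⁅ i ⁆
    downClosed : ∀ {F G} → G ⊆ F → Face F → Face G

open SimplicialComplex public

-- d = max { |F| : F ∈ Δ }, that is, dim Δ = d - 1.
IsMaxFaceSize : ∀ {n} → SimplicialComplex n → ℕ → Set
IsMaxFaceSize Δ d =
  (∃[ F ] Face Δ F × ∣ F ∣ ≡ d) × (∀ F → Face Δ F → ∣ F ∣ ℕ.≤ d)

allSubsets : ∀ n → List (Subset n)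
allSubsets zero    = [ Vec.[] ]
allSubsets (suc n) =
  map (outside Vec.∷_) (allSubsets n) ++ map (inside Vec.∷_) (allSubsets n)

-- The entry f_i of the f-vector: faces with i + 1 elements.
fEntry : ∀ {n} → SimplicialComplex n → ℕ → ℕ
fEntry {n} Δ i =
  length (filter (λ F → face? Δ F ×-dec (∣ F ∣ ℕ.≟ suc i)) (allSubsets n))

HasFVector : ∀ {n d} → SimplicialComplex n → Vector ℤ d → Set
HasFVector Δ f = ∀ i → + fEntry Δ (toℕ i) ≡ f i

-- Facets and leaves are defined for an arbitrary family Γ of faces, since a
-- subcomplex ⟨ Fs ⟩ need not contain every vertex of [n].
IsFacet : ∀ {n} → Pred (Subset n) 0ℓ → Subset n → Set
IsFacet Γ F = Γ F × (∀ G → Γ G → F ⊆ G → G ≡ F)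

⟨_⟩ : ∀ {n} → List (Subset n) → Pred (Subset n) 0ℓ
⟨ Fs ⟩ G = Any (G ⊆_) Fs

IsBranch : ∀ {n} → Pred (Subset n) 0ℓ → Subset n → Subset n → Set
IsBranch Γ F G =
  IsFacet Γ G × G ≢ F × (∀ H → IsFacet Γ H → H ≢ F → (H ∩ F) ⊆ (G ∩ F))

-- The first alternative is the convention that a unique facet is a leaf.
IsLeaf : ∀ {n} → Pred (Subset n) 0ℓ → Subset n → Set
IsLeaf Γ F =
  IsFacet Γ F × ((∀ H → IsFacet Γ H → H ≡ F) ⊎ (∃[ G ] IsBranch Γ F G))

IsFacetOrdering : ∀ {n} → SimplicialComplex n → List (Subset n) → Set
IsFacetOrdering Δ Fs = Unique Fs × (∀ F → F ∈ Fs ⇔ IsFacet (Face Δ) F)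

-- Positions are counted from 0, so 1 < j ≤ s becomes 0 < toℕ j < length Fs.
IsLeafOrder : ∀ {n} → SimplicialComplex n → List (Subset n) → Set
IsLeafOrder Δ Fs =
  IsFacetOrdering Δ Fs ×
  (∀ (j : Fin (length Fs)) → 0 ℕ.< toℕ j →
     IsLeaf ⟨ take (suc (toℕ j)) Fs ⟩ (lookup Fs j))

IsQuasiForest : ∀ {n} → SimplicialComplex n → Set
IsQuasiForest Δ = ∃[ Fs ] IsLeafOrder Δ Fs

-- A set of facets is given by a list; repetitions do not affect ⟨ Fs ⟩.
IsForest : ∀ {n} → SimplicialComplex n → Set
IsForest Δ =
  ∀ Fs → Fs ≢ [] → All (IsFacet (Face Δ)) Fs → ∃[ F ] IsLeaf ⟨ Fs ⟩ F

-- Polynomials over ℤ: lists of coefficients, constant term first, compared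
-- up to trailing zeros by _≈ₚ_.
Poly : Set
Poly = List ℤ

coeff : Poly → ℕ → ℤ
coeff []      _       = 0ℤ
coeff (a ∷ p) zero    = a
coeff (a ∷ p) (suc k) = coeff p k

infix  4 _≈ₚ_
infixl 6 _+ₚ_
infixl 7 _*ₚ_ _·ₚ_
infixr 8 _^ₚ_

_≈ₚ_ : Poly → Poly → Set
p ≈ₚ q = ∀ k → coeff p k ≡ coeff q k

_+ₚ_ : Poly → Poly → Poly
[]      +ₚ q       = q
(a ∷ p) +ₚ []      = a ∷ p
(a ∷ p) +ₚ (b ∷ q) = (a ℤ.+ b) ∷ (p +ₚ q)

_·ₚ_ : ℤ → Poly → Poly
a ·ₚ p = map (a ℤ.*_) p

_*ₚ_ : Poly → Poly → Poly
[]      *ₚ q = []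
(a ∷ p) *ₚ q = a ·ₚ q +ₚ (0ℤ ∷ (p *ₚ q))

_^ₚ_ : Poly → ℕ → Poly
p ^ₚ zero  = [ 1ℤ ]
p ^ₚ suc k = p *ₚ (p ^ₚ k)

x : Poly
x = 0ℤ ∷ 1ℤ ∷ []

x-1 : Poly
x-1 = x +ₚ [ -1ℤ ]

-- ∑ᵢ aᵢ pⁱ for i = 0, …, m - 1.
∑[_]_^i : ∀ {m} → Vector ℤ m → Poly → Poly
∑[ a ] p ^i = Vector.foldr _+ₚ_ [] (λ i → a i ·ₚ p ^ₚ toℕ i)

-- ∑ cᵢ over k ≤ i < m.
tailSum : ∀ {m} → Vector ℤ m → Fin m → ℤ
tailSum {m} c k = foldr ℤ._+_ 0ℤ (map c (filter (k Fin.≤?_) (allFin m)))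

module _ {d : ℕ} (f : Vector ℤ d) where

  QuasiForestCondition : Set₁
  QuasiForestCondition = ∃[ n ] ∃[ Δ ]
    IsQuasiForest {n} Δ × IsMaxFaceSize Δ d × HasFVector Δ f

  ForestCondition : Set₁
  ForestCondition = ∃[ n ] ∃[ Δ ]
    IsForest {n} Δ × IsMaxFaceSize Δ d × HasFVector Δ f

  -- Prepending 1 = f₋₁ makes f_{i-1} the entry at index i.  The cᵢ are
  -- uniquely determined by the polynomial identity.
  CCondition : Set
  CCondition = ∃[ c ]
    (∑[ 1ℤ Vector.∷ f ] x-1 ^i ≈ₚ ∑[ c ] x ^i) ×
    (∀ (k : Fin (suc d)) → 1 ℕ.≤ toℕ k → 0ℤ ℤ.< tailSum {suc d} c k)

  -- b i stands for b_{i+1}, the coefficient of xⁱ.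
  BCondition : Set
  BCondition = ∃[ b ]
    (∑[ f ] x-1 ^i ≈ₚ ∑[ b ] x ^i) ×
    (∀ (i : Fin d) → 0ℤ ℤ.< b i)

{-# OPTIONS --safe #-}
-- Write β_k for the coefficient of x^k in ∑_{∅ ≠ S ∈ Δ} (x - 1)^(∣S∣ - 1), which is b_{k+1}.
-- A simplex on m vertices contributes (x^m - 1)/(x - 1), that is, 1 to each β_k with k < m.
-- If F is a leaf with branch G, then ⟨F⟩ meets the rest of the complex in ⟨F ∩ G⟩, so
-- adding F increases β_k by 1 exactly for ∣F ∩ G∣ ≤ k < ∣F∣; along a leaf order all b's
-- become positive.  Conversely, starting from a simplex on d vertices and attaching b_k - 1
-- new vertices to its first k - 1 vertices, for each k, gives a complex with prescribed
-- positive b's.  It is a forest because the pairwise intersections of its facets form a chain.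
-- The tail sums of the c's telescope to the b's since ∑ cᵢ xⁱ = 1 + (x - 1) ∑ bᵢ xⁱ⁻¹.
module Submission where

open import Defs
open import Algebra.Properties.Semiring.Sum as SemiringSum using ()
import Data.Bool as Bool
open import Data.Empty using (⊥-elim)
open import Data.Fin as Fin using (Fin; zero; suc; toℕ; fromℕ<)
open import Data.Fin.Properties using (toℕ<n; toℕ-fromℕ<)
open import Data.Fin.Subset as Subset using (Subset; inside; outside; _⊆_; _⊂_; _∩_; ∣_∣)
open import Data.Fin.Subset.Properties
open import Data.Integer as ℤ using (ℤ; 0ℤ; 1ℤ; -1ℤ; _+_; _*_; _-_)
open import Data.Integer.Properties as ℤ using ()
open import Data.Integer.Tactic.RingSolver using (solve-∀)
open import Data.List as List using (List; []; _∷_; _∷ʳ_; _++_; length; take; lookup)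
open import Data.List.Membership.Propositional using (_∈_; _∉_; lose; find)
open import Data.List.Membership.Propositional.Properties
import Data.List.Properties as List
open import Data.List.Relation.Binary.Permutation.Propositional using (_↭_; ↭-refl; ↭-sym; ↭-trans; prep; ↭⇒↭ₛ)
open import Data.List.Relation.Binary.Permutation.Propositional.Properties using (∈-resp-↭; Any-resp-↭; shift; ∷↭∷ʳ)
open import Data.List.Relation.Binary.Permutation.Setoid.Properties using (Unique-resp-↭)
open import Data.List.Relation.Unary.All as All using ()
open import Data.List.Relation.Unary.AllPairs as AllPairs using ()
open import Data.List.Relation.Unary.Any as Any using (here; there)
import Data.List.Relation.Unary.Any.Properties as Any
open import Data.List.Relation.Unary.Unique.Propositional using (Unique)
import Data.List.Relation.Unary.Unique.Propositional.Properties as Unique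
open import Data.Nat as ℕ using (ℕ; zero; suc; s≤s; z≤n)
open import Data.Nat.Properties as ℕ using ()
open import Data.Product using (_×_; _,_; proj₁; proj₂; ∃-syntax)
open import Data.Sum using (_⊎_; inj₁; inj₂)
open import Data.Vec as Vec using ()
import Data.Vec.Properties as Vec
open import Data.Vec.Functional as Vector using (Vector)
open import Function using (_∘_)
open import Function.Bundles using (_⇔_; mk⇔; Equivalence)
open import Level using (0ℓ)
open import Relation.Binary.PropositionalEquality
open import Relation.Nullary using (yes; no; ¬_; ¬?; Dec; contradiction)
open import Relation.Nullary.Decidable using (_×-dec_)
open import Relation.Unary using (Pred; Decidable; _≐_)

open SemiringSum ℤ.+-*-semiring using (sum; sum-cong-≗; ∑-distrib-+; sum-replicate-zero)

open ≡-Reasoning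

private variable
  n d : ℕ
  P R Γ Γ′ : Pred (Subset n) 0ℓ

-- Finite sums and indicator functions

∑-neg : ∀ {n} (f : Vector ℤ n) → sum (λ i → ℤ.- f i) ≡ ℤ.- sum f
∑-neg {zero}  f = refl
∑-neg {suc n} f = trans (cong (ℤ.- f zero +_) (∑-neg (f ∘ suc))) (sym (ℤ.neg-distrib-+ (f zero) _))

∑-distrib-- : ∀ {n} (f g : Vector ℤ n) → sum (λ i → f i - g i) ≡ sum f - sum g
∑-distrib-- f g = trans (∑-distrib-+ f (λ i → ℤ.- g i)) (cong (sum f +_) (∑-neg g))

sum-zero : ∀ {n} {f : Vector ℤ n} → (∀ i → f i ≡ 0ℤ) → sum f ≡ 0ℤ
sum-zero {n} f≗0 = trans (sum-cong-≗ f≗0) (sum-replicate-zero n)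

-- Kronecker delta, by recursion on both arguments so that raising both by one is a definitional
-- identity.
δ : ℕ → ℕ → ℤ
δ zero    zero    = 1ℤ
δ zero    (suc k) = 0ℤ
δ (suc m) zero    = 0ℤ
δ (suc m) (suc k) = δ m k

-- χ k m = 1 if k < m, and 0 otherwise.
χ : ℕ → ℕ → ℤ
χ k       zero    = 0ℤ
χ zero    (suc m) = 1ℤ
χ (suc k) (suc m) = χ k m

χ-suc : ∀ k m → χ k (suc m) ≡ χ k m + δ m k
χ-suc zero    zero    = refl
χ-suc zero    (suc m) = refl
χ-suc (suc k) zero    = refl
χ-suc (suc k) (suc m) = χ-suc k m

χ-< : ∀ {k m} → k ℕ.< m → χ k m ≡ 1ℤ
χ-< {zero}  (s≤s _)   = refl
χ-< {suc k} (s≤s k<m) = χ-< k<m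

χ-≥ : ∀ {k m} → m ℕ.≤ k → χ k m ≡ 0ℤ
χ-≥ z≤n       = refl
χ-≥ (s≤s m≤k) = χ-≥ m≤k

δ-diagonal : ∀ m → δ m m ≡ 1ℤ
δ-diagonal zero    = refl
δ-diagonal (suc m) = δ-diagonal m

δ-≢ : ∀ {m k} → m ≢ k → δ m k ≡ 0ℤ
δ-≢ {zero}  {zero}  m≢k = contradiction refl m≢k
δ-≢ {zero}  {suc k} m≢k = refl
δ-≢ {suc m} {zero}  m≢k = refl
δ-≢ {suc m} {suc k} m≢k = δ-≢ (m≢k ∘ cong suc)

sum-δ-out : ∀ {n} (a : Vector ℤ n) {k} → n ℕ.≤ k → sum (λ i → a i * δ (toℕ i) k) ≡ 0ℤ
sum-δ-out a n≤k = sum-zero λ i → trans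
  (cong (a i *_) (δ-≢ (ℕ.<⇒≢ (ℕ.<-≤-trans (toℕ<n i) n≤k))))
  (ℤ.*-zeroʳ (a i))

sum-δ : ∀ {n} (a : Vector ℤ n) k → sum (λ i → a i * δ (toℕ i) (toℕ k)) ≡ a k
sum-δ {suc n} a zero = begin
  a zero * 1ℤ + sum (λ i → a (suc i) * 0ℤ)
    ≡⟨ cong₂ _+_ (ℤ.*-identityʳ (a zero)) (sum-zero λ i → ℤ.*-zeroʳ (a (suc i))) ⟩
  a zero + 0ℤ  ≡⟨ ℤ.+-identityʳ (a zero) ⟩
  a zero       ∎
sum-δ {suc n} a (suc k) = begin
  a zero * 0ℤ + sum (λ i → a (suc i) * δ (toℕ i) (toℕ k))
    ≡⟨ cong₂ _+_ (ℤ.*-zeroʳ (a zero)) (sum-δ (a ∘ suc) k) ⟩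
  0ℤ + a (suc k)  ≡⟨ ℤ.+-identityˡ (a (suc k)) ⟩
  a (suc k)       ∎

-- Coefficients of polynomials

coeff-+ₚ : ∀ p q k → coeff (p +ₚ q) k ≡ coeff p k + coeff q k
coeff-+ₚ []      q       k       = sym (ℤ.+-identityˡ (coeff q k))
coeff-+ₚ (a ∷ p) []      k       = sym (ℤ.+-identityʳ (coeff (a ∷ p) k))
coeff-+ₚ (a ∷ p) (b ∷ q) zero    = refl
coeff-+ₚ (a ∷ p) (b ∷ q) (suc k) = coeff-+ₚ p q k

coeff-·ₚ : ∀ a p k → coeff (a ·ₚ p) k ≡ a * coeff p k
coeff-·ₚ a []      k       = sym (ℤ.*-zeroʳ a)
coeff-·ₚ a (b ∷ p) zero    = refl
coeff-·ₚ a (b ∷ p) (suc k) = coeff-·ₚ a p k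

coeff-0∷[] : ∀ k → coeff (0ℤ ∷ []) k ≡ 0ℤ
coeff-0∷[] zero    = refl
coeff-0∷[] (suc k) = refl

coeff-linear*-zero : ∀ a q → coeff ((a ∷ 1ℤ ∷ []) *ₚ q) 0 ≡ a * coeff q 0
coeff-linear*-zero a q = begin
  coeff ((a ∷ 1ℤ ∷ []) *ₚ q) 0  ≡⟨ coeff-+ₚ (a ·ₚ q) _ 0 ⟩
  coeff (a ·ₚ q) 0 + 0ℤ         ≡⟨ ℤ.+-identityʳ _ ⟩
  coeff (a ·ₚ q) 0              ≡⟨ coeff-·ₚ a q 0 ⟩
  a * coeff q 0                 ∎

coeff-linear*-suc : ∀ a q k →
  coeff ((a ∷ 1ℤ ∷ []) *ₚ q) (suc k) ≡ a * coeff q (suc k) + coeff q k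
coeff-linear*-suc a q k = begin
  coeff ((a ∷ 1ℤ ∷ []) *ₚ q) (suc k)
    ≡⟨ coeff-+ₚ (a ·ₚ q) _ (suc k) ⟩
  coeff (a ·ₚ q) (suc k) + coeff (1ℤ ·ₚ q +ₚ (0ℤ ∷ [])) k
    ≡⟨ cong₂ _+_ (coeff-·ₚ a q (suc k)) (coeff-+ₚ (1ℤ ·ₚ q) _ k) ⟩
  a * coeff q (suc k) + (coeff (1ℤ ·ₚ q) k + coeff (0ℤ ∷ []) k)
    ≡⟨ cong (λ z → a * coeff q (suc k) + z) (cong₂ _+_ (coeff-·ₚ 1ℤ q k) (coeff-0∷[] k)) ⟩
  a * coeff q (suc k) + (1ℤ * coeff q k + 0ℤ)
    ≡⟨ cong (λ z → a * coeff q (suc k) + z) (trans (ℤ.+-identityʳ _) (ℤ.*-identityˡ _)) ⟩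
  a * coeff q (suc k) + coeff q k
    ∎

coeff-x^ : ∀ m k → coeff (x ^ₚ m) k ≡ δ m k
coeff-x^ zero    zero    = refl
coeff-x^ zero    (suc k) = refl
coeff-x^ (suc m) zero    = trans (coeff-linear*-zero 0ℤ (x ^ₚ m)) (ℤ.*-zeroˡ (coeff (x ^ₚ m) 0))
coeff-x^ (suc m) (suc k) = begin
  coeff (x ^ₚ suc m) (suc k)                    ≡⟨ coeff-linear*-suc 0ℤ (x ^ₚ m) k ⟩
  0ℤ * coeff (x ^ₚ m) (suc k) + coeff (x ^ₚ m) k ≡⟨ cong (_+ coeff (x ^ₚ m) k) (ℤ.*-zeroˡ (coeff (x ^ₚ m) (suc k))) ⟩
  0ℤ + coeff (x ^ₚ m) k                         ≡⟨ ℤ.+-identityˡ _ ⟩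
  coeff (x ^ₚ m) k                              ≡⟨ coeff-x^ m k ⟩
  δ m k                                         ∎

-- Powers of x - 1 and the expansion of polynomials in x - 1

w : ℕ → ℕ → ℤ
w i k = coeff (x-1 ^ₚ i) k

w-zero : ∀ k → w 0 k ≡ δ 0 k
w-zero zero    = refl
w-zero (suc k) = refl

w-suc-zero : ∀ i → w (suc i) 0 ≡ ℤ.- w i 0
w-suc-zero i = trans (coeff-linear*-zero -1ℤ (x-1 ^ₚ i)) (ℤ.-1*i≡-i _)

w-suc-suc : ∀ i k → w (suc i) (suc k) ≡ w i k - w i (suc k)
w-suc-suc i k = begin
  w (suc i) (suc k)               ≡⟨ coeff-linear*-suc -1ℤ (x-1 ^ₚ i) k ⟩
  -1ℤ * w i (suc k) + w i k       ≡⟨ cong (_+ w i k) (ℤ.-1*i≡-i (w i (suc k))) ⟩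
  ℤ.- w i (suc k) + w i k         ≡⟨ ℤ.+-comm (ℤ.- w i (suc k)) (w i k) ⟩
  w i k - w i (suc k)             ∎

-- The degree of (x - 1)^i is i.
w-> : ∀ {i k} → i ℕ.< k → w i k ≡ 0ℤ
w-> {zero}  {suc k} _         = refl
w-> {suc i} {suc k} (s≤s i<k) =
  trans (w-suc-suc i k) (cong₂ _-_ (w-> i<k) (w-> (ℕ.m<n⇒m<1+n i<k)))

coeff-∑ : ∀ {m} (a : Vector ℤ m) p k →
  coeff (∑[ a ] p ^i) k ≡ sum (λ i → a i * coeff (p ^ₚ toℕ i) k)
coeff-∑ a p k = trans (coeff-foldr (λ i → a i ·ₚ p ^ₚ toℕ i))
  (sum-cong-≗ λ i → coeff-·ₚ (a i) (p ^ₚ toℕ i) k)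
  where
  coeff-foldr : ∀ {m} (ps : Vector Poly m) →
    coeff (Vector.foldr _+ₚ_ [] ps) k ≡ sum (λ i → coeff (ps i) k)
  coeff-foldr {zero}  ps = refl
  coeff-foldr {suc m} ps = trans (coeff-+ₚ (ps zero) _ k)
    (cong (coeff (ps zero) k +_) (coeff-foldr (ps ∘ suc)))

coeff-∑x : ∀ {m} (a : Vector ℤ m) k → coeff (∑[ a ] x ^i) k ≡ sum (λ i → a i * δ (toℕ i) k)
coeff-∑x a k = trans (coeff-∑ a x k)
  (sum-cong-≗ λ i → cong (a i *_) (coeff-x^ (toℕ i) k))

coeff-∑x-in : ∀ {m} (a : Vector ℤ m) i → coeff (∑[ a ] x ^i) (toℕ i) ≡ a i
coeff-∑x-in a i = trans (coeff-∑x a (toℕ i)) (sum-δ a i)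

coeff-∑x-out : ∀ {m} (a : Vector ℤ m) {k} → m ℕ.≤ k → coeff (∑[ a ] x ^i) k ≡ 0ℤ
coeff-∑x-out a {k} m≤k = trans (coeff-∑x a k) (sum-δ-out a m≤k)

-- Applied to `f` this gives the b's, with b_{k+1} at index k; applied to `1ℤ Vector.∷ f` it gives
-- the c's, with c_k at index k.
bCoeff : ∀ {m} → Vector ℤ m → ℕ → ℤ
bCoeff a k = coeff (∑[ a ] x-1 ^i) k

bCoeff-out : ∀ {m} (a : Vector ℤ m) {k} → m ℕ.≤ k → bCoeff a k ≡ 0ℤ
bCoeff-out a {k} m≤k = trans (coeff-∑ a x-1 k) (sum-zero λ i → trans
  (cong (a i *_) (w-> (ℕ.<-≤-trans (toℕ<n i) m≤k)))
  (ℤ.*-zeroʳ (a i)))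

-- Both polynomials have degree less than m, so only the first m coefficients have to be compared.
≈ₚ-∑x : ∀ {m} (a b : Vector ℤ m) → (∀ i → bCoeff a (toℕ i) ≡ b i) → ∑[ a ] x-1 ^i ≈ₚ ∑[ b ] x ^i
≈ₚ-∑x {m} a b bCoeff≡b k with k ℕ.<? m
... | yes k<m = subst (λ k → bCoeff a k ≡ coeff (∑[ b ] x ^i) k) (toℕ-fromℕ< k<m)
                  (trans (bCoeff≡b (fromℕ< k<m)) (sym (coeff-∑x-in b (fromℕ< k<m))))
... | no  k≮m = trans (bCoeff-out a (ℕ.≮⇒≥ k≮m)) (sym (coeff-∑x-out b (ℕ.≮⇒≥ k≮m)))

bCoeff-zero : ∀ {m} (a : Vector ℤ (suc m)) → bCoeff a 0 ≡ a zero - bCoeff (a ∘ suc) 0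
bCoeff-zero a = begin
  bCoeff a 0
    ≡⟨ coeff-∑ a x-1 0 ⟩
  a zero * 1ℤ + sum (λ i → a (suc i) * w (suc (toℕ i)) 0)
    ≡⟨ cong₂ _+_ (ℤ.*-identityʳ (a zero)) (sum-cong-≗ λ i → trans
         (cong (a (suc i) *_) (w-suc-zero (toℕ i)))
         (sym (ℤ.neg-distribʳ-* (a (suc i)) (w (toℕ i) 0)))) ⟩
  a zero + sum (λ i → ℤ.- (a (suc i) * w (toℕ i) 0))
    ≡⟨ cong (a zero +_) (∑-neg (λ i → a (suc i) * w (toℕ i) 0)) ⟩
  a zero - sum (λ i → a (suc i) * w (toℕ i) 0)
    ≡⟨ cong (λ s → a zero - s) (coeff-∑ (a ∘ suc) x-1 0) ⟨
  a zero - bCoeff (a ∘ suc) 0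
    ∎

-- Write ∑ aᵢ (x - 1)^i as a₀ + (x - 1) q, where q belongs to the shifted vector, and compare
-- coefficients of x^(k+1). This recurrence drives both the injectivity below and the telescoping of
-- the c's.
bCoeff-suc : ∀ {m} (a : Vector ℤ (suc m)) k → bCoeff a (suc k) ≡ bCoeff (a ∘ suc) k - bCoeff (a ∘ suc) (suc k)
bCoeff-suc a k = begin
  bCoeff a (suc k)
    ≡⟨ coeff-∑ a x-1 (suc k) ⟩
  a zero * 0ℤ + sum (λ i → a (suc i) * w (suc (toℕ i)) (suc k))
    ≡⟨ cong₂ _+_ (ℤ.*-zeroʳ (a zero)) (sum-cong-≗ λ i → trans
         (cong (a (suc i) *_) (w-suc-suc (toℕ i) k))
         (distrib (a (suc i)) (w (toℕ i) k) (w (toℕ i) (suc k)))) ⟩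
  0ℤ + sum (λ i → a (suc i) * w (toℕ i) k - a (suc i) * w (toℕ i) (suc k))
    ≡⟨ ℤ.+-identityˡ _ ⟩
  sum (λ i → a (suc i) * w (toℕ i) k - a (suc i) * w (toℕ i) (suc k))
    ≡⟨ ∑-distrib-- (λ i → a (suc i) * w (toℕ i) k) (λ i → a (suc i) * w (toℕ i) (suc k)) ⟩
  sum (λ i → a (suc i) * w (toℕ i) k) - sum (λ i → a (suc i) * w (toℕ i) (suc k))
    ≡⟨ cong₂ _-_ (coeff-∑ (a ∘ suc) x-1 k) (coeff-∑ (a ∘ suc) x-1 (suc k)) ⟨
  bCoeff (a ∘ suc) k - bCoeff (a ∘ suc) (suc k)
    ∎
  where
  distrib : ∀ a b c → a * (b - c) ≡ a * b - a * c
  distrib = solve-∀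

a-b+b≡a : ∀ a b → a - b + b ≡ a
a-b+b≡a = solve-∀

-- The powers of x - 1 are linearly independent: the recurrence determines the coefficients of the
-- shifted vector from the top down, and then the constant coefficient determines the first entry.
-- It is used to recover an f-vector from its b's.
bCoeff-injective : ∀ {m} (a b : Vector ℤ m) → (∀ k → bCoeff a k ≡ bCoeff b k) → ∀ i → a i ≡ b i
bCoeff-injective {suc m} a b a≈b = λ where
    zero    → a₀≡b₀
    (suc i) → bCoeff-injective (a ∘ suc) (b ∘ suc) tails i
  where
  -- Agreement at index j + k is carried down to k, since `bCoeff-suc` gives the differences of
  -- neighbouring coefficients.
  descend : ∀ j k → bCoeff (a ∘ suc) (j ℕ.+ k) ≡ bCoeff (b ∘ suc) (j ℕ.+ k) → bCoeff (a ∘ suc) k ≡ bCoeff (b ∘ suc) k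
  descend zero    k eq = eq
  descend (suc j) k eq = descend j k (begin
    bCoeff (a ∘ suc) (j ℕ.+ k)
      ≡⟨ a-b+b≡a _ (bCoeff (a ∘ suc) (suc (j ℕ.+ k))) ⟨
    bCoeff (a ∘ suc) (j ℕ.+ k) - bCoeff (a ∘ suc) (suc (j ℕ.+ k)) + bCoeff (a ∘ suc) (suc (j ℕ.+ k))
      ≡⟨ cong₂ _+_ (trans (sym (bCoeff-suc a (j ℕ.+ k))) (trans (a≈b (suc (j ℕ.+ k))) (bCoeff-suc b (j ℕ.+ k)))) eq ⟩
    bCoeff (b ∘ suc) (j ℕ.+ k) - bCoeff (b ∘ suc) (suc (j ℕ.+ k)) + bCoeff (b ∘ suc) (suc (j ℕ.+ k))
      ≡⟨ a-b+b≡a _ (bCoeff (b ∘ suc) (suc (j ℕ.+ k))) ⟩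
    bCoeff (b ∘ suc) (j ℕ.+ k)
      ∎)

  tails : ∀ k → bCoeff (a ∘ suc) k ≡ bCoeff (b ∘ suc) k
  -- The descent starts at index m + k, beyond the degree, where both coefficients are 0.
  tails k = descend m k (trans (bCoeff-out (a ∘ suc) (ℕ.m≤m+n m k)) (sym (bCoeff-out (b ∘ suc) (ℕ.m≤m+n m k))))

  a₀≡b₀ : a zero ≡ b zero
  a₀≡b₀ = begin
    a zero
      ≡⟨ a-b+b≡a (a zero) (bCoeff (a ∘ suc) 0) ⟨
    a zero - bCoeff (a ∘ suc) 0 + bCoeff (a ∘ suc) 0
      ≡⟨ cong₂ _+_ (trans (sym (bCoeff-zero a)) (trans (a≈b 0) (bCoeff-zero b))) (tails 0) ⟩
    b zero - bCoeff (b ∘ suc) 0 + bCoeff (b ∘ suc) 0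
      ≡⟨ a-b+b≡a (b zero) (bCoeff (b ∘ suc) 0) ⟩
    b zero
      ∎

-- Tail sums

filter-map : ∀ {A B : Set} {P : Pred B 0ℓ} (P? : Decidable P) (f : A → B) xs →
  List.filter P? (List.map f xs) ≡ List.map f (List.filter (P? ∘ f) xs)
filter-map P? f []       = refl
filter-map P? f (x ∷ xs) with P? (f x)
... | yes _ = cong (f x ∷_) (filter-map P? f xs)
... | no  _ = filter-map P? f xs

tailSum-suc : ∀ {m} (c : Vector ℤ (suc m)) k → tailSum c (suc k) ≡ tailSum (c ∘ suc) k
tailSum-suc {m} c k = cong (List.foldr _+_ 0ℤ) (begin
  List.map c (List.filter (suc k Fin.≤?_) (List.tabulate suc))
    ≡⟨ cong (List.map c ∘ List.filter (suc k Fin.≤?_)) (List.map-tabulate (λ i → i) suc) ⟨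
  List.map c (List.filter (suc k Fin.≤?_) (List.map suc (List.allFin m)))
    ≡⟨ cong (List.map c) (filter-map (suc k Fin.≤?_) suc (List.allFin m)) ⟩
  List.map c (List.map suc (List.filter (λ i → suc k Fin.≤? suc i) (List.allFin m)))
    ≡⟨ List.map-∘ _ ⟨
  List.map (c ∘ suc) (List.filter (λ i → suc k Fin.≤? suc i) (List.allFin m))
    ≡⟨ cong (List.map (c ∘ suc)) (List.filter-≐ (λ i → suc k Fin.≤? suc i) (k Fin.≤?_) (ℕ.s≤s⁻¹ , s≤s) (List.allFin m)) ⟩
  List.map (c ∘ suc) (List.filter (k Fin.≤?_) (List.allFin m))
    ∎)

tailSum-zero : ∀ {m} (c : Vector ℤ (suc m)) → tailSum c zero ≡ sum c
tailSum-zero {m} c = trans (all-kept (List.allFin (suc m))) (total c)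
  where
  all-kept : ∀ is → List.foldr _+_ 0ℤ (List.map c (List.filter (zero {m} Fin.≤?_) is))
                  ≡ List.foldr _+_ 0ℤ (List.map c is)
  all-kept []       = refl
  all-kept (i ∷ is) = cong (c i +_) (all-kept is)

  total : ∀ {m} (c : Vector ℤ m) → List.foldr _+_ 0ℤ (List.map c (List.allFin m)) ≡ sum c
  total {m} c = trans (cong (List.foldr _+_ 0ℤ) (List.map-tabulate (λ i → i) c)) (go c)
    where
    go : ∀ {m} (c : Vector ℤ m) → List.foldr _+_ 0ℤ (List.tabulate c) ≡ sum c
    go {zero}  c = refl
    go {suc m} c = cong (c zero +_) (go (c ∘ suc))

tailSum-telescope : ∀ {m} (c : Vector ℤ m) (q : ℕ → ℤ) → (∀ i → c i ≡ q (toℕ i) - q (suc (toℕ i))) →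
  ∀ k → tailSum c k ≡ q (toℕ k) - q m
tailSum-telescope c q c≡Δq (suc k) = trans (tailSum-suc c k)
  (tailSum-telescope (c ∘ suc) (q ∘ suc) (c≡Δq ∘ suc) k)
tailSum-telescope c q c≡Δq zero = trans (tailSum-zero c) (telescope c q c≡Δq)
  where
  chain : ∀ a b c → a - b + (b - c) ≡ a - c
  chain = solve-∀
  telescope : ∀ {m} (c : Vector ℤ m) (q : ℕ → ℤ) → (∀ i → c i ≡ q (toℕ i) - q (suc (toℕ i))) →
    sum c ≡ q 0 - q m
  telescope {zero}  c q c≡Δq = sym (ℤ.+-inverseʳ (q 0))
  telescope {suc m} c q c≡Δq = trans
    (cong₂ _+_ (c≡Δq zero) (telescope (c ∘ suc) (q ∘ suc) (c≡Δq ∘ suc)))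
    (chain (q 0) (q 1) (q (suc m)))

-- By `bCoeff-suc`, the entry of c at i + 1 is the difference of the coefficients of `f` at i and i
-- + 1. The sum telescopes, and its last term is 0 because the degree is below d.
tailSum-bCoeff : ∀ {d} (f : Vector ℤ d) (c : Vector ℤ (suc d)) →
  (∀ i → bCoeff (1ℤ Vector.∷ f) (toℕ i) ≡ c i) → ∀ k → tailSum c (suc k) ≡ bCoeff f (toℕ k)
tailSum-bCoeff {d} f c bCoeff≡c k = begin
  tailSum c (suc k)
    ≡⟨ tailSum-suc c k ⟩
  tailSum (c ∘ suc) k
    ≡⟨ tailSum-telescope (c ∘ suc) (bCoeff f) (λ i → trans (sym (bCoeff≡c (suc i))) (bCoeff-suc (1ℤ Vector.∷ f) (toℕ i))) k ⟩
  bCoeff f (toℕ k) - bCoeff f d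
    ≡⟨ cong (λ z → bCoeff f (toℕ k) - z) (bCoeff-out f ℕ.≤-refl) ⟩
  bCoeff f (toℕ k) - 0ℤ
    ≡⟨ ℤ.+-identityʳ _ ⟩
  bCoeff f (toℕ k)
    ∎

-- Conditions (iii) and (iv) as positivity of the b's

AllPositive : Vector ℤ d → Set
AllPositive {d} f = ∀ (i : Fin d) → 0ℤ ℤ.< bCoeff f (toℕ i)

BCondition⇒positive : (f : Vector ℤ d) → BCondition f → AllPositive f
BCondition⇒positive f (b , f≈b , 0<b) i =
  subst (0ℤ ℤ.<_) (sym (trans (f≈b (toℕ i)) (coeff-∑x-in b i))) (0<b i)

positive⇒BCondition : (f : Vector ℤ d) → AllPositive f → BCondition f
positive⇒BCondition f 0<b = bCoeff f ∘ toℕ , ≈ₚ-∑x f (bCoeff f ∘ toℕ) (λ i → refl) , 0<b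

CCondition⇒positive : (f : Vector ℤ d) → CCondition f → AllPositive f
CCondition⇒positive f (c , f≈c , 0<tails) i = subst (0ℤ ℤ.<_)
  (tailSum-bCoeff f c (λ j → trans (f≈c (toℕ j)) (coeff-∑x-in c j)) i)
  (0<tails (suc i) (s≤s z≤n))

positive⇒CCondition : (f : Vector ℤ d) → AllPositive f → CCondition f
positive⇒CCondition f 0<b = c , ≈ₚ-∑x (1ℤ Vector.∷ f) c (λ i → refl) , λ where
    (suc k) _ → subst (0ℤ ℤ.<_) (sym (tailSum-bCoeff f c (λ i → refl) k)) (0<b k)
  where
  c = bCoeff (1ℤ Vector.∷ f) ∘ toℕ

-- Sums over all subsets

𝟙 : ∀ {A : Set} → Dec A → ℤ
𝟙 (yes _) = 1ℤ
𝟙 (no  _) = 0ℤ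

𝟙-yes : ∀ {A : Set} (A? : Dec A) → A → 𝟙 A? ≡ 1ℤ
𝟙-yes (yes _)  a = refl
𝟙-yes (no  ¬a) a = contradiction a ¬a

𝟙-no : ∀ {A : Set} (A? : Dec A) → ¬ A → 𝟙 A? ≡ 0ℤ
𝟙-no (yes a) ¬a = contradiction a ¬a
𝟙-no (no  _) ¬a = refl

𝟙-cong : ∀ {A B : Set} (A? : Dec A) (B? : Dec B) → (A → B) → (B → A) → 𝟙 A? ≡ 𝟙 B?
𝟙-cong (yes a) B? f g = sym (𝟙-yes B? (f a))
𝟙-cong (no ¬a) B? f g = sym (𝟙-no B? (¬a ∘ g))

-- The recursion splits on the first vertex, as `allSubsets` does, so that sums over faces can be
-- handled by induction on the vertex set.
∑ₛ : (Subset n → ℤ) → ℤ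
∑ₛ {zero}  g = g Vec.[]
∑ₛ {suc n} g = ∑ₛ (g ∘ (outside Vec.∷_)) + ∑ₛ (g ∘ (inside Vec.∷_))

∑ₛ-cong : {g h : Subset n → ℤ} → (∀ S → g S ≡ h S) → ∑ₛ g ≡ ∑ₛ h
∑ₛ-cong {zero}  g≗h = g≗h Vec.[]
∑ₛ-cong {suc n} g≗h = cong₂ _+_ (∑ₛ-cong (g≗h ∘ (outside Vec.∷_))) (∑ₛ-cong (g≗h ∘ (inside Vec.∷_)))

∑ₛ-zero : {g : Subset n → ℤ} → (∀ S → g S ≡ 0ℤ) → ∑ₛ g ≡ 0ℤ
∑ₛ-zero {zero}  g≗0 = g≗0 Vec.[]
∑ₛ-zero {suc n} g≗0 = cong₂ _+_ (∑ₛ-zero (g≗0 ∘ (outside Vec.∷_))) (∑ₛ-zero (g≗0 ∘ (inside Vec.∷_)))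

∑ₛ-distrib-+ : (g h : Subset n → ℤ) → ∑ₛ (λ S → g S + h S) ≡ ∑ₛ g + ∑ₛ h
∑ₛ-distrib-+ {zero}  g h = refl
∑ₛ-distrib-+ {suc n} g h = trans
  (cong₂ _+_ (∑ₛ-distrib-+ (g ∘ (outside Vec.∷_)) (h ∘ (outside Vec.∷_)))
             (∑ₛ-distrib-+ (g ∘ (inside Vec.∷_)) (h ∘ (inside Vec.∷_))))
  (interchange (∑ₛ (g ∘ (outside Vec.∷_))) (∑ₛ (h ∘ (outside Vec.∷_))) (∑ₛ (g ∘ (inside Vec.∷_))) (∑ₛ (h ∘ (inside Vec.∷_))))
  where
  interchange : ∀ a b c d → a + b + (c + d) ≡ a + c + (b + d)
  interchange = solve-∀

∑ₛ-distribʳ-* : (g : Subset n → ℤ) (a : ℤ) → ∑ₛ g * a ≡ ∑ₛ (λ S → g S * a)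
∑ₛ-distribʳ-* {zero}  g a = refl
∑ₛ-distribʳ-* {suc n} g a = trans
  (ℤ.*-distribʳ-+ a (∑ₛ (g ∘ (outside Vec.∷_))) (∑ₛ (g ∘ (inside Vec.∷_))))
  (cong₂ _+_ (∑ₛ-distribʳ-* (g ∘ (outside Vec.∷_)) a) (∑ₛ-distribʳ-* (g ∘ (inside Vec.∷_)) a))

∑ₛ-sum-comm : ∀ {m} (g : Subset n → Vector ℤ m) → ∑ₛ (λ S → sum (g S)) ≡ sum (λ i → ∑ₛ (λ S → g S i))
∑ₛ-sum-comm {zero}  g = refl
∑ₛ-sum-comm {suc n} g = trans
  (cong₂ _+_ (∑ₛ-sum-comm (g ∘ (outside Vec.∷_))) (∑ₛ-sum-comm (g ∘ (inside Vec.∷_))))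
  (sym (∑-distrib-+ (λ i → ∑ₛ (λ S → g (outside Vec.∷ S) i)) (λ i → ∑ₛ (λ S → g (inside Vec.∷ S) i))))

-- This turns the counts in `fEntry` into sums of indicators, where the order of summation can be
-- exchanged.
length-filter-allSubsets : (P? : Decidable P) →
  ℤ.+ List.length (List.filter P? (allSubsets n)) ≡ ∑ₛ (𝟙 ∘ P?)
length-filter-allSubsets {n = zero} P? with P? Vec.[]
... | yes _ = refl
... | no  _ = refl
length-filter-allSubsets {n = suc n} P? = begin
  ℤ.+ List.length (List.filter P? (List.map (outside Vec.∷_) (allSubsets n) List.++ List.map (inside Vec.∷_) (allSubsets n)))
    ≡⟨ cong (ℤ.+_ ∘ List.length) (List.filter-++ P? (List.map (outside Vec.∷_) (allSubsets n)) _) ⟩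
  ℤ.+ List.length (half outside List.++ half inside)
    ≡⟨ cong ℤ.+_ (List.length-++ (half outside)) ⟩
  ℤ.+ (List.length (half outside) ℕ.+ List.length (half inside))
    ≡⟨ ℤ.pos-+ (List.length (half outside)) (List.length (half inside)) ⟩
  ℤ.+ List.length (half outside) + ℤ.+ List.length (half inside)
    ≡⟨ cong₂ _+_ (count-half outside) (count-half inside) ⟩
  ∑ₛ (𝟙 ∘ P?)
    ∎
  where
  half : _ → List (Subset (suc n))
  half s = List.filter P? (List.map (s Vec.∷_) (allSubsets n))
  count-half : ∀ s → ℤ.+ List.length (half s) ≡ ∑ₛ (𝟙 ∘ P? ∘ (s Vec.∷_))
  count-half s = trans
    (cong ℤ.+_ (trans (cong List.length (filter-map P? (s Vec.∷_) (allSubsets n)))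
                      (List.length-map (s Vec.∷_) (List.filter (P? ∘ (s Vec.∷_)) (allSubsets n)))))
    (length-filter-allSubsets (P? ∘ (s Vec.∷_)))

weight : (ℕ → ℤ) → Decidable P → ℤ
weight φ P? = ∑ₛ (λ S → 𝟙 (P? S) * φ ∣ S ∣)

weight-cong : ∀ φ (P? : Decidable P) (R? : Decidable R) → P ≐ R → weight φ P? ≡ weight φ R?
weight-cong φ P? R? (P⊆R , R⊆P) =
  ∑ₛ-cong λ S → cong (_* φ ∣ S ∣) (𝟙-cong (P? S) (R? S) P⊆R R⊆P)

-- The coefficient of xᵏ in (x - 1)^(s - 1); the empty face (s = 0) does not enter the b's.
bWeight : ℕ → ℕ → ℤ
bWeight k zero    = 0ℤ
bWeight k (suc s) = w s k

-- Exchange the sum over dimensions with the sum over subsets: a nonempty face with t + 1 elements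
-- is counted at the single index t, with weight `w t k`. The bound on face sizes puts this index in
-- range.
bCoeff-fVector : (Δ : SimplicialComplex n) (f : Vector ℤ d) →
  (∀ F → Face Δ F → ∣ F ∣ ℕ.≤ d) → HasFVector Δ f → ∀ k → bCoeff f k ≡ weight (bWeight k) (face? Δ)
bCoeff-fVector {n} {d} Δ f bounded fΔ≡f k = begin
  bCoeff f k
    ≡⟨ coeff-∑ f x-1 k ⟩
  sum (λ i → f i * w (toℕ i) k)
    ≡⟨ sum-cong-≗ (λ i → trans
         (cong (_* w (toℕ i) k) (trans (sym (fΔ≡f i)) (length-filter-allSubsets (inFᵢ? i))))
         (∑ₛ-distribʳ-* (𝟙 ∘ inFᵢ? i) (w (toℕ i) k))) ⟩
  sum (λ i → ∑ₛ (λ S → 𝟙 (inFᵢ? i S) * w (toℕ i) k))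
    ≡⟨ ∑ₛ-sum-comm (λ S i → 𝟙 (inFᵢ? i S) * w (toℕ i) k) ⟨
  ∑ₛ (λ S → sum (λ i → 𝟙 (inFᵢ? i S) * w (toℕ i) k))
    ≡⟨ ∑ₛ-cong pointwise ⟩
  weight (bWeight k) (face? Δ)
    ∎
  where
  inFᵢ? : ∀ (i : Fin d) → Decidable (λ S → Face Δ S × ∣ S ∣ ≡ suc (toℕ i))
  inFᵢ? i S = face? Δ S ×-dec (∣ S ∣ ℕ.≟ suc (toℕ i))

  select : ∀ {A : Set} s → s ℕ.≤ d → A → (D : ∀ i → Dec (A × s ≡ suc (toℕ i))) →
    sum (λ i → 𝟙 (D i) * w (toℕ i) k) ≡ bWeight k s
  -- The empty face matches no index, in accordance with the value 0 of `bWeight k zero`.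
  select zero    _   a D = sum-zero λ i → cong (_* w (toℕ i) k) (𝟙-no (D i) (λ ()))
  select (suc t) t<d a D = begin
    sum (λ i → 𝟙 (D i) * w (toℕ i) k)      ≡⟨ sum-cong-≗ term ⟩
    sum (λ i → wₖ i * δ (toℕ i) t)          ≡⟨ cong (λ t → sum (λ i → wₖ i * δ (toℕ i) t)) (toℕ-fromℕ< t<d) ⟨
    sum (λ i → wₖ i * δ (toℕ i) (toℕ t′))   ≡⟨ sum-δ wₖ t′ ⟩
    wₖ t′                                   ≡⟨ cong (λ t → w t k) (toℕ-fromℕ< t<d) ⟩
    w t k                                   ∎
    where
    t′ = fromℕ< t<d
    wₖ : Vector ℤ d
    wₖ i = w (toℕ i) k
    term : ∀ i → 𝟙 (D i) * w (toℕ i) k ≡ w (toℕ i) k * δ (toℕ i) t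
    term i with toℕ i ℕ.≟ t
    ... | yes i≡t = trans (ℤ.*-comm (𝟙 (D i)) _) (cong (w (toℕ i) k *_)
                      (trans (𝟙-yes (D i) (a , cong suc (sym i≡t))) (sym (trans (cong (δ (toℕ i)) (sym i≡t)) (δ-diagonal (toℕ i))))))
    ... | no  i≢t = trans (ℤ.*-comm (𝟙 (D i)) _) (cong (w (toℕ i) k *_)
                      (trans (𝟙-no (D i) (i≢t ∘ sym ∘ ℕ.suc-injective ∘ proj₂)) (sym (δ-≢ i≢t))))

  pointwise : ∀ S → sum (λ i → 𝟙 (inFᵢ? i S) * w (toℕ i) k) ≡ 𝟙 (face? Δ S) * bWeight k ∣ S ∣
  pointwise S = go (face? Δ S)
    where
    go : (D : Dec (Face Δ S)) → sum (λ i → 𝟙 (inFᵢ? i S) * w (toℕ i) k) ≡ 𝟙 D * bWeight k ∣ S ∣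
    go (yes S∈Δ) = trans (select ∣ S ∣ (bounded S S∈Δ) S∈Δ (λ i → inFᵢ? i S)) (sym (ℤ.*-identityˡ _))
    go (no  S∉Δ) = trans (sum-zero λ i → trans (cong (_* w (toℕ i) k) (𝟙-no (inFᵢ? i S) (S∉Δ ∘ proj₁))) (ℤ.*-zeroˡ (w (toℕ i) k)))
                         (sym (ℤ.*-zeroˡ (bWeight k ∣ S ∣)))

-- Simplices

-- ∑_{S ⊆ F} φ ∣S∣ for ∣F∣ = m, by deleting a vertex of F.
simplexWeight : ℕ → (ℕ → ℤ) → ℤ
simplexWeight zero    φ = φ 0
simplexWeight (suc m) φ = simplexWeight m φ + simplexWeight m (φ ∘ suc)

simplexWeight-cong : ∀ m {φ ψ : ℕ → ℤ} → (∀ s → φ s ≡ ψ s) → simplexWeight m φ ≡ simplexWeight m ψ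
simplexWeight-cong zero    φ≗ψ = φ≗ψ 0
simplexWeight-cong (suc m) φ≗ψ = cong₂ _+_ (simplexWeight-cong m φ≗ψ) (simplexWeight-cong m (φ≗ψ ∘ suc))

simplexWeight-distrib-+ : ∀ m (φ ψ : ℕ → ℤ) →
  simplexWeight m φ + simplexWeight m ψ ≡ simplexWeight m (λ s → φ s + ψ s)
simplexWeight-distrib-+ zero    φ ψ = refl
simplexWeight-distrib-+ (suc m) φ ψ = trans
  (interchange (simplexWeight m φ) _ (simplexWeight m ψ) _)
  (cong₂ _+_ (simplexWeight-distrib-+ m φ ψ) (simplexWeight-distrib-+ m (φ ∘ suc) (ψ ∘ suc)))
  where
  interchange : ∀ a b c d → a + b + (c + d) ≡ a + c + (b + d)
  interchange = solve-∀

in⊈out : ∀ {S F : Subset n} → ¬ (inside Vec.∷ S) ⊆ (outside Vec.∷ F)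
in⊈out S⊆F with S⊆F Vec.here
... | ()

-- Split on the first vertex. If it lies in F, the subsets through it have one more element than
-- their remainders, hence `φ ∘ suc`; if it does not, they contribute nothing.
weight-simplex : ∀ φ (F : Subset n) → weight φ (_⊆? F) ≡ simplexWeight ∣ F ∣ φ
weight-simplex φ Vec.[] = trans (cong (_* φ 0) (𝟙-yes (Vec.[] ⊆? Vec.[]) ⊆-refl)) (ℤ.*-identityˡ (φ 0))
weight-simplex φ (inside Vec.∷ F) = cong₂ _+_
  (trans (∑ₛ-cong λ S → cong (_* φ ∣ S ∣) (𝟙-cong ((outside Vec.∷ S) ⊆? (inside Vec.∷ F)) (S ⊆? F) drop-∷-⊆ out⊆))
         (weight-simplex φ F))
  (trans (∑ₛ-cong λ S → cong (_* φ (suc ∣ S ∣)) (𝟙-cong ((inside Vec.∷ S) ⊆? (inside Vec.∷ F)) (S ⊆? F) drop-∷-⊆ in⊆in))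
         (weight-simplex (φ ∘ suc) F))
weight-simplex φ (outside Vec.∷ F) = trans (cong₂ _+_
  (trans (∑ₛ-cong λ S → cong (_* φ ∣ S ∣) (𝟙-cong ((outside Vec.∷ S) ⊆? (outside Vec.∷ F)) (S ⊆? F) drop-∷-⊆ out⊆))
         (weight-simplex φ F))
  (∑ₛ-zero λ S → trans (cong (_* φ (suc ∣ S ∣)) (𝟙-no ((inside Vec.∷ S) ⊆? (outside Vec.∷ F)) in⊈out))
                       (ℤ.*-zeroˡ (φ (suc ∣ S ∣)))))
  (ℤ.+-identityʳ _)

-- ∑_{S ⊆ F} (x - 1)^∣S∣ = x^∣F∣, coefficientwise.
simplexWeight-w : ∀ m k → simplexWeight m (λ s → w s k) ≡ δ m k
simplexWeight-w zero    k       = w-zero k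
simplexWeight-w (suc m) zero    = begin
  simplexWeight m (λ s → w s 0) + simplexWeight m (λ s → w (suc s) 0)
    ≡⟨ simplexWeight-distrib-+ m (λ s → w s 0) (λ s → w (suc s) 0) ⟩
  simplexWeight m (λ s → w s 0 + w (suc s) 0)
    ≡⟨ simplexWeight-cong m (λ s → trans (cong (w s 0 +_) (w-suc-zero s)) (ℤ.+-inverseʳ (w s 0))) ⟩
  simplexWeight m (λ s → 0ℤ)
    ≡⟨ vanish m ⟩
  0ℤ
    ∎
  where
  vanish : ∀ m → simplexWeight m (λ s → 0ℤ) ≡ 0ℤ
  vanish zero    = refl
  vanish (suc m) = cong₂ _+_ (vanish m) (vanish m)
simplexWeight-w (suc m) (suc k) = begin
  simplexWeight m (λ s → w s (suc k)) + simplexWeight m (λ s → w (suc s) (suc k))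
    ≡⟨ simplexWeight-distrib-+ m (λ s → w s (suc k)) (λ s → w (suc s) (suc k)) ⟩
  simplexWeight m (λ s → w s (suc k) + w (suc s) (suc k))
    ≡⟨ simplexWeight-cong m (λ s → trans (cong (w s (suc k) +_) (w-suc-suc s k)) (cancel (w s (suc k)) (w s k))) ⟩
  simplexWeight m (λ s → w s k)
    ≡⟨ simplexWeight-w m k ⟩
  δ m k
    ∎
  where
  cancel : ∀ a b → a + (b - a) ≡ b
  cancel = solve-∀

-- A new vertex adds the subsets through it, whose weights sum to x^m by `simplexWeight-w`. The
-- total is therefore 1 + x + ... + x^(m-1), which is (x^m - 1)/(x - 1).
simplexWeight-bWeight : ∀ k m → simplexWeight m (bWeight k) ≡ χ k m
simplexWeight-bWeight k zero    = refl
simplexWeight-bWeight k (suc m) = trans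
  (cong₂ _+_ (simplexWeight-bWeight k m) (simplexWeight-w m k))
  (sym (χ-suc k m))

-- Adding a leaf

⟨_⟩? : (Fs : List (Subset n)) → Decidable ⟨ Fs ⟩
⟨ Fs ⟩? S = Any.any? (S ⊆?_) Fs

-- The number b_{k+1} of the complex generated by a list, so that facets can be added one at a time
-- even while some vertices are still uncovered.
β : ℕ → List (Subset n) → ℤ
β k Fs = weight (bWeight k) ⟨ Fs ⟩?

β-[-] : ∀ k (F : Subset n) → β k (F ∷ []) ≡ χ k ∣ F ∣
β-[-] k F = trans
  (weight-cong (bWeight k) ⟨ F ∷ [] ⟩? (_⊆? F) ((λ where (here S⊆F) → S⊆F) , here))
  (trans (weight-simplex (bWeight k) F) (simplexWeight-bWeight k ∣ F ∣))

-- Inclusion–exclusion: ⟨ F ⟩ ∩ ⟨ Fs ⟩ = ⟨ F ∩ G ⟩.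
β-∷ : ∀ k {F G : Subset n} {Fs} → G ∈ Fs → (∀ {H} → H ∈ Fs → H ∩ F ⊆ G) →
  β k (F ∷ Fs) ≡ β k Fs + (χ k ∣ F ∣ - χ k ∣ F ∩ G ∣)
β-∷ k {F} {G} {Fs} G∈Fs H∩F⊆G = begin
  β k (F ∷ Fs)
    ≡⟨ a≡a+b-b (β k (F ∷ Fs)) (weight φ (_⊆? (F ∩ G))) ⟩
  β k (F ∷ Fs) + weight φ (_⊆? (F ∩ G)) - weight φ (_⊆? (F ∩ G))
    ≡⟨ cong (_- weight φ (_⊆? (F ∩ G))) (begin
         β k (F ∷ Fs) + weight φ (_⊆? (F ∩ G))
           ≡⟨ ∑ₛ-distrib-+ (λ S → 𝟙 (⟨ F ∷ Fs ⟩? S) * φ ∣ S ∣) (λ S → 𝟙 (S ⊆? (F ∩ G)) * φ ∣ S ∣) ⟨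
         ∑ₛ (λ S → 𝟙 (⟨ F ∷ Fs ⟩? S) * φ ∣ S ∣ + 𝟙 (S ⊆? (F ∩ G)) * φ ∣ S ∣)
           ≡⟨ ∑ₛ-cong (λ S → begin
                𝟙 (⟨ F ∷ Fs ⟩? S) * φ ∣ S ∣ + 𝟙 (S ⊆? (F ∩ G)) * φ ∣ S ∣
                  ≡⟨ ℤ.*-distribʳ-+ (φ ∣ S ∣) (𝟙 (⟨ F ∷ Fs ⟩? S)) (𝟙 (S ⊆? (F ∩ G))) ⟨
                (𝟙 (⟨ F ∷ Fs ⟩? S) + 𝟙 (S ⊆? (F ∩ G))) * φ ∣ S ∣
                  ≡⟨ cong (_* φ ∣ S ∣) (inclusion-exclusion S (S ⊆? F) (⟨ Fs ⟩? S)) ⟩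
                (𝟙 (⟨ Fs ⟩? S) + 𝟙 (S ⊆? F)) * φ ∣ S ∣
                  ≡⟨ ℤ.*-distribʳ-+ (φ ∣ S ∣) (𝟙 (⟨ Fs ⟩? S)) (𝟙 (S ⊆? F)) ⟩
                𝟙 (⟨ Fs ⟩? S) * φ ∣ S ∣ + 𝟙 (S ⊆? F) * φ ∣ S ∣
                  ∎) ⟩
         ∑ₛ (λ S → 𝟙 (⟨ Fs ⟩? S) * φ ∣ S ∣ + 𝟙 (S ⊆? F) * φ ∣ S ∣)
           ≡⟨ ∑ₛ-distrib-+ (λ S → 𝟙 (⟨ Fs ⟩? S) * φ ∣ S ∣) (λ S → 𝟙 (S ⊆? F) * φ ∣ S ∣) ⟩
         β k Fs + weight φ (_⊆? F)
           ∎) ⟩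
  β k Fs + weight φ (_⊆? F) - weight φ (_⊆? (F ∩ G))
    ≡⟨ ℤ.+-assoc (β k Fs) (weight φ (_⊆? F)) _ ⟩
  β k Fs + (weight φ (_⊆? F) - weight φ (_⊆? (F ∩ G)))
    ≡⟨ cong (β k Fs +_) (cong₂ _-_ (simplex F) (simplex (F ∩ G))) ⟩
  β k Fs + (χ k ∣ F ∣ - χ k ∣ F ∩ G ∣)
    ∎
  where
  φ = bWeight k

  a≡a+b-b : ∀ a b → a ≡ a + b - b
  a≡a+b-b = solve-∀

  simplex : ∀ F → weight φ (_⊆? F) ≡ χ k ∣ F ∣
  simplex F = trans (weight-simplex φ F) (simplexWeight-bWeight k ∣ F ∣)

  inclusion-exclusion : ∀ S (inF : Dec (S ⊆ F)) (inFs : Dec (⟨ Fs ⟩ S)) →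
    𝟙 (⟨ F ∷ Fs ⟩? S) + 𝟙 (S ⊆? (F ∩ G)) ≡ 𝟙 inFs + 𝟙 inF
  inclusion-exclusion S (yes S⊆F) (yes S∈Fs) = cong₂ _+_
    (𝟙-yes (⟨ F ∷ Fs ⟩? S) (there S∈Fs))
    (𝟙-yes (S ⊆? (F ∩ G)) (λ v∈S → x∈p∩q⁺ (S⊆F v∈S , S⊆G v∈S)))
    where
    S⊆G : S ⊆ G
    S⊆G v∈S with H , H∈Fs , S⊆H ← find S∈Fs = H∩F⊆G H∈Fs (x∈p∩q⁺ (S⊆H v∈S , S⊆F v∈S))
  inclusion-exclusion S (yes S⊆F) (no S∉Fs) = cong₂ _+_
    (𝟙-yes (⟨ F ∷ Fs ⟩? S) (here S⊆F))
    (𝟙-no (S ⊆? (F ∩ G)) (λ S⊆F∩G → S∉Fs (lose G∈Fs (λ v∈S → p∩q⊆q F G (S⊆F∩G v∈S)))))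
  inclusion-exclusion S (no S⊈F) (yes S∈Fs) = cong₂ _+_
    (𝟙-yes (⟨ F ∷ Fs ⟩? S) (there S∈Fs))
    (𝟙-no (S ⊆? (F ∩ G)) (λ S⊆F∩G → S⊈F (λ v∈S → p∩q⊆p F G (S⊆F∩G v∈S))))
  inclusion-exclusion S (no S⊈F) (no S∉Fs) = cong₂ _+_
    (𝟙-no (⟨ F ∷ Fs ⟩? S) (λ where (here S⊆F) → S⊈F S⊆F ; (there S∈Fs) → S∉Fs S∈Fs))
    (𝟙-no (S ⊆? (F ∩ G)) (λ S⊆F∩G → S⊈F (λ v∈S → p∩q⊆p F G (S⊆F∩G v∈S))))

-- A vertex outside all generators lies in no face, so enlarging the vertex set by it changes
-- nothing.
β-map-outside : ∀ k (Fs : List (Subset n)) → β k (List.map (outside Vec.∷_) Fs) ≡ β k Fs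
β-map-outside k Fs = trans (cong₂ _+_
  (∑ₛ-cong λ S → cong (_* bWeight k ∣ S ∣) (𝟙-cong (⟨ Fs⁺ ⟩? (outside Vec.∷ S)) (⟨ Fs ⟩? S)
    (Any.map drop-∷-⊆ ∘ Any.map⁻) (Any.map⁺ ∘ Any.map out⊆)))
  (∑ₛ-zero λ S → trans
    (cong (_* bWeight k (suc ∣ S ∣)) (𝟙-no (⟨ Fs⁺ ⟩? (inside Vec.∷ S)) (λ S∈ → in∉ (Any.map⁻ S∈))))
    (ℤ.*-zeroˡ (bWeight k (suc ∣ S ∣)))))
  (ℤ.+-identityʳ _)
  where
  Fs⁺ = List.map (outside Vec.∷_) Fs
  in∉ : ∀ {S Fs} → ¬ Any.Any (λ F → (inside Vec.∷ S) ⊆ (outside Vec.∷ F)) Fs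
  in∉ (here S⊆F) = in⊈out S⊆F
  in∉ (there S∈) = in∉ S∈

-- A leaf order, latest facet first, reduced to its branch conditions.
data LeafChain {n} : List (Subset n) → Set where
  [_]  : ∀ F → LeafChain (F ∷ [])
  grow : ∀ {F G Fs} → G ∈ Fs → (∀ {H} → H ∈ Fs → H ∩ F ⊆ G) → LeafChain Fs → LeafChain (F ∷ Fs)

χ-nonneg : ∀ k m → 0ℤ ℤ.≤ χ k m
χ-nonneg k       zero    = ℤ.≤-refl
χ-nonneg zero    (suc m) = ℤ.+≤+ z≤n
χ-nonneg (suc k) (suc m) = χ-nonneg k m

χ-mono : ∀ k {m n} → m ℕ.≤ n → χ k m ℤ.≤ χ k n
χ-mono k       {n = n} z≤n = χ-nonneg k n
χ-mono zero    (s≤s m≤n) = ℤ.≤-refl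
χ-mono (suc k) (s≤s m≤n) = χ-mono k m≤n

increment-nonneg : ∀ k (F G : Subset n) → 0ℤ ℤ.≤ χ k ∣ F ∣ - χ k ∣ F ∩ G ∣
increment-nonneg k F G = ℤ.i≤j⇒0≤j-i (χ-mono k (∣p∩q∣≤∣p∣ F G))

β-nonneg : ∀ k {Fs : List (Subset n)} → LeafChain Fs → 0ℤ ℤ.≤ β k Fs
β-nonneg k [ F ] = subst (0ℤ ℤ.≤_) (sym (β-[-] k F)) (χ-nonneg k ∣ F ∣)
β-nonneg k (grow {F} {G} G∈Fs H∩F⊆G chain) = subst (0ℤ ℤ.≤_) (sym (β-∷ k G∈Fs H∩F⊆G))
  (ℤ.+-mono-≤ (β-nonneg k chain) (increment-nonneg k F G))

-- When F is added with branch G, either the increment at k is 1, or k is below the size of F ∩ G;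
-- then G also has more than k elements and the earlier chain is already positive at k. Later
-- increments are nonnegative.
β-positive : ∀ k {Fs : List (Subset n)} → LeafChain Fs → ∀ {F} → F ∈ Fs → k ℕ.< ∣ F ∣ → 0ℤ ℤ.< β k Fs
β-positive k [ F ] (here refl) k<∣F∣ =
  subst (0ℤ ℤ.<_) (sym (trans (β-[-] k F) (χ-< k<∣F∣))) (ℤ.+<+ (s≤s z≤n))
β-positive k (grow {F} {G} G∈Fs H∩F⊆G chain) (there F′∈Fs) k<∣F′∣ =
  subst (0ℤ ℤ.<_) (sym (β-∷ k G∈Fs H∩F⊆G))
    (ℤ.+-mono-<-≤ (β-positive k chain F′∈Fs k<∣F′∣) (increment-nonneg k F G))
β-positive k (grow {F} {G} {Fs} G∈Fs H∩F⊆G chain) (here refl) k<∣F∣ with k ℕ.<? ∣ F ∩ G ∣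
... | yes k<∣F∩G∣ = subst (0ℤ ℤ.<_) (sym (β-∷ k G∈Fs H∩F⊆G))
  (ℤ.+-mono-<-≤ (β-positive k chain G∈Fs (ℕ.<-≤-trans k<∣F∩G∣ (∣p∩q∣≤∣q∣ F G))) (increment-nonneg k F G))
... | no  k≮∣F∩G∣ = subst (0ℤ ℤ.<_)
  (sym (trans (β-∷ k G∈Fs H∩F⊆G) (cong (β k Fs +_) (cong₂ _-_ (χ-< k<∣F∣) (χ-≥ (ℕ.≮⇒≥ k≮∣F∩G∣))))))
  (ℤ.+-mono-≤-< (β-nonneg k chain) (ℤ.+<+ (s≤s z≤n)))

_≟ₛ_ : (F G : Subset n) → Dec (F ≡ G)
_≟ₛ_ = Vec.≡-dec Bool._≟_

-- Facets

IsFacet-resp-≐ : Γ ≐ Γ′ → ∀ {F} → IsFacet Γ F → IsFacet Γ′ F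
IsFacet-resp-≐ (Γ⊆Γ′ , Γ′⊆Γ) (F∈Γ , maximal) = Γ⊆Γ′ F∈Γ , λ G G∈Γ′ → maximal G (Γ′⊆Γ G∈Γ′)

IsLeaf-resp-≐ : Γ ≐ Γ′ → ∀ {F} → IsLeaf Γ F → IsLeaf Γ′ F
IsLeaf-resp-≐ Γ≐Γ′@(Γ⊆Γ′ , Γ′⊆Γ) (facet , inj₁ unique) =
  IsFacet-resp-≐ Γ≐Γ′ facet , inj₁ λ H → unique H ∘ IsFacet-resp-≐ (Γ′⊆Γ , Γ⊆Γ′)
IsLeaf-resp-≐ Γ≐Γ′@(Γ⊆Γ′ , Γ′⊆Γ) (facet , inj₂ (G , facetG , G≢F , covers)) =
  IsFacet-resp-≐ Γ≐Γ′ facet ,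
  inj₂ (G , IsFacet-resp-≐ Γ≐Γ′ facetG , G≢F , λ H → covers H ∘ IsFacet-resp-≐ (Γ′⊆Γ , Γ⊆Γ′))

facet⇒∈ : ∀ {Fs : List (Subset n)} {F} → IsFacet ⟨ Fs ⟩ F → F ∈ Fs
facet⇒∈ (F∈⟨Fs⟩ , maximal) with K , K∈Fs , F⊆K ← find F∈⟨Fs⟩ =
  subst (_∈ _) (maximal K (lose K∈Fs ⊆-refl) F⊆K) K∈Fs

module _ (Δ : SimplicialComplex n) where

  -- A generator containing F is itself a face of Δ, so maximality of F in Δ forces the two to
  -- coincide.
  ∈⇒facet : ∀ {Fs} → (∀ {F} → F ∈ Fs → IsFacet (Face Δ) F) → ∀ {F} → F ∈ Fs → IsFacet ⟨ Fs ⟩ F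
  ∈⇒facet facets {F} F∈Fs = lose F∈Fs ⊆-refl , maximal
    where
    maximal : ∀ G → ⟨ _ ⟩ G → F ⊆ G → G ≡ F
    maximal G G∈⟨Fs⟩ F⊆G with K , K∈Fs , G⊆K ← find G∈⟨Fs⟩ =
      ⊆-antisym (subst (G ⊆_) K≡F G⊆K) F⊆G
      where
      K≡F : K ≡ F
      K≡F = proj₂ (facets F∈Fs) K (proj₁ (facets K∈Fs)) (⊆-trans F⊆G G⊆K)

  -- A finite search over all subsets; it makes being a facet decidable and supplies each step of
  -- the climb from a face to a facet.
  facet-or-enlarge : ∀ {F} → Face Δ F → IsFacet (Face Δ) F ⊎ ∃[ G ] Face Δ G × F ⊂ G
  facet-or-enlarge {F} F∈Δ with anySubset? (λ G → face? Δ G ×-dec (F ⊂? G))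
  ... | yes larger = inj₂ larger
  ... | no  none   = inj₁ (F∈Δ , λ G G∈Δ F⊆G → ⊆-antisym (G⊆F G G∈Δ F⊆G) F⊆G)
    where
    G⊆F : ∀ G → Face Δ G → F ⊆ G → G ⊆ F
    G⊆F G G∈Δ F⊆G {v} v∈G with v ∈? F
    ... | yes v∈F = v∈F
    ... | no  v∉F = ⊥-elim (none (G , G∈Δ , F⊆G , v , v∈G , v∉F))

  facet? : Decidable (IsFacet (Face Δ))
  facet? F with face? Δ F
  ... | no  F∉Δ = no (F∉Δ ∘ proj₁)
  ... | yes F∈Δ with facet-or-enlarge F∈Δ
  ...   | inj₁ facet             = yes facet
  ...   | inj₂ (G , G∈Δ , F⊆G , v , v∈G , v∉F) =
            no λ (_ , maximal) → v∉F (subst (v Subset.∈_) (maximal G G∈Δ F⊆G) v∈G)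

  face⊆facet : ∀ {F} → Face Δ F → ∃[ G ] IsFacet (Face Δ) G × F ⊆ G
  face⊆facet {F} = go n (ℕ.m≤m+n n ∣ F ∣)
    where
    -- `m` bounds the number of enlargements still possible: each one adds a vertex, and a face has
    -- at most n of them.
    go : ∀ m {F} → n ℕ.≤ m ℕ.+ ∣ F ∣ → Face Δ F → ∃[ G ] IsFacet (Face Δ) G × F ⊆ G
    go m {F} n≤m+∣F∣ F∈Δ with facet-or-enlarge F∈Δ
    ... | inj₁ facet = F , facet , ⊆-refl
    go zero n≤∣F∣ F∈Δ | inj₂ (G , G∈Δ , F⊂G) =
      contradiction (ℕ.<-≤-trans (p⊂q⇒∣p∣<∣q∣ F⊂G) (ℕ.≤-trans (∣p∣≤n G) n≤∣F∣)) (ℕ.<-irrefl refl)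
    go (suc m) {F} n≤m+∣F∣ F∈Δ | inj₂ (G , G∈Δ , F⊂G)
      with K , facet , G⊆K ← go m (ℕ.≤-trans n≤m+∣F∣ (ℕ.≤-trans (ℕ.≤-reflexive (sym (ℕ.+-suc m ∣ F ∣)))
                                    (ℕ.+-monoʳ-≤ m (p⊂q⇒∣p∣<∣q∣ F⊂G)))) G∈Δ
      = K , facet , ⊆-trans (p⊂q⇒p⊆q F⊂G) G⊆K

  Face≐⟨facets⟩ : ∀ {Fs} → (∀ F → F ∈ Fs ⇔ IsFacet (Face Δ) F) → Face Δ ≐ ⟨ Fs ⟩
  Face≐⟨facets⟩ {Fs} facets = to , from
    where
    to : ∀ {S} → Face Δ S → ⟨ Fs ⟩ S
    to S∈Δ with F , facet , S⊆F ← face⊆facet S∈Δ = lose (Equivalence.from (facets F) facet) S⊆F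
    from : ∀ {S} → ⟨ Fs ⟩ S → Face Δ S
    from S∈⟨Fs⟩ with F , F∈Fs , S⊆F ← find S∈⟨Fs⟩ =
      downClosed Δ S⊆F (proj₁ (Equivalence.to (facets F) F∈Fs))

-- From quasi-forests to condition (iv)

  -- The convention for a unique facet cannot apply, because A is a facet different from F. In the
  -- other case the branch is a facet of the generated complex other than F, hence one of `Fs`.
  leaf⇒branch : ∀ {Fs F A} → (∀ {H} → H ∈ Fs ∷ʳ F → IsFacet (Face Δ) H) → F ∉ Fs → A ∈ Fs →
    IsLeaf ⟨ Fs ∷ʳ F ⟩ F → ∃[ G ] G ∈ Fs × (∀ {H} → H ∈ Fs → H ∩ F ⊆ G)
  leaf⇒branch {Fs} {F} facets F∉Fs A∈Fs (_ , inj₁ unique) =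
    contradiction (subst (_∈ Fs) (unique _ (∈⇒facet facets (∈-++⁺ˡ A∈Fs))) A∈Fs) F∉Fs
  leaf⇒branch {Fs} {F} facets F∉Fs A∈Fs (_ , inj₂ (G , facetG , G≢F , covers)) = G , G∈Fs , H∩F⊆G
    where
    G∈Fs : G ∈ Fs
    G∈Fs with ∈-++⁻ Fs (facet⇒∈ facetG)
    ... | inj₁ G∈Fs       = G∈Fs
    ... | inj₂ (here G≡F) = contradiction G≡F G≢F
    H∩F⊆G : ∀ {H} → H ∈ Fs → H ∩ F ⊆ G
    H∩F⊆G {H} H∈Fs v∈H∩F = p∩q⊆p G F (covers H (∈⇒facet facets (∈-++⁺ˡ H∈Fs))
      (λ H≡F → F∉Fs (subst (_∈ Fs) H≡F H∈Fs)) v∈H∩F)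

  chain-nonempty : ∀ {As : List (Subset n)} → LeafChain As → ∃[ A ] A ∈ As
  chain-nonempty [ A ]            = A , here refl
  chain-nonempty (grow {F} _ _ _) = F , here refl

  -- `Fs` is the part of the leaf order already processed, and `As` holds the same facets as a
  -- chain. Tracking them up to permutation is enough, since only the generated complex enters `β`.
  leafOrder⇒chain : ∀ {As} Fs Gs → LeafChain As → As ↭ Fs → Unique (Fs ++ Gs) →
    (∀ {F} → F ∈ Fs ++ Gs → IsFacet (Face Δ) F) →
    (∀ j → IsLeaf ⟨ Fs ++ take (suc (toℕ j)) Gs ⟩ (lookup Gs j)) →
    ∃[ Cs ] LeafChain Cs × Cs ↭ Fs ++ Gs
  leafOrder⇒chain {As} Fs [] chain As↭Fs _ _ _ = As , chain , subst (As ↭_) (sym (List.++-identityʳ Fs)) As↭Fs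
  leafOrder⇒chain {As} Fs (F ∷ Gs) chain As↭Fs unique facets leaves =
    extend (leaf⇒branch (facets ∘ reassociate ∘ ∈-++⁺ˡ) F∉Fs
      (∈-resp-↭ As↭Fs (proj₂ (chain-nonempty chain))) (leaves zero))
    where
    reassociate : ∀ {H} → H ∈ Fs ∷ʳ F ++ Gs → H ∈ Fs ++ F ∷ Gs
    reassociate = subst (_ ∈_) (List.∷ʳ-++ Fs F Gs)

    F∉Fs : F ∉ Fs
    F∉Fs F∈Fs = All.lookup (AllPairs.head (Unique-resp-↭ (setoid _) (↭⇒↭ₛ (shift F Fs Gs)) unique))
      (∈-++⁺ˡ F∈Fs) refl

    extend : ∃[ G ] G ∈ Fs × (∀ {H} → H ∈ Fs → H ∩ F ⊆ G) → ∃[ Cs ] LeafChain Cs × Cs ↭ Fs ++ F ∷ Gs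
    extend (G , G∈Fs , H∩F⊆G) = subst (λ Hs → ∃[ Cs ] LeafChain Cs × Cs ↭ Hs) (List.∷ʳ-++ Fs F Gs)
      (leafOrder⇒chain (Fs ∷ʳ F) Gs
        (grow (∈-resp-↭ (↭-sym As↭Fs) G∈Fs) (λ H∈As → H∩F⊆G (∈-resp-↭ As↭Fs H∈As)) chain)
        (↭-trans (prep F As↭Fs) (∷↭∷ʳ F Fs))
        (subst Unique (sym (List.∷ʳ-++ Fs F Gs)) unique)
        (facets ∘ reassociate)
        (λ j → subst (λ Hs → IsLeaf ⟨ Hs ⟩ (lookup Gs j))
          (sym (List.∷ʳ-++ Fs F (take (suc (toℕ j)) Gs))) (leaves (suc j))))

-- The member F excludes an empty list. The first facet starts the chain; leaf conditions begin at
-- position 1, hence the shift to `suc j`.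
leafChain : (Δ : SimplicialComplex n) → ∀ {Fs F} → F ∈ Fs → IsLeafOrder Δ Fs →
  ∃[ Cs ] LeafChain Cs × Cs ↭ Fs
leafChain Δ {A ∷ Bs} _ ((unique , facets) , leaves) =
  leafOrder⇒chain Δ (A ∷ []) Bs [ A ] ↭-refl unique
    (λ {F} → Equivalence.to (facets F)) (λ j → leaves (suc j) (s≤s z≤n))

-- A face with d elements lies in a facet K, which thus has more than i elements for every i below
-- d, so `β-positive` applies to K.
quasiForest⇒positive : (f : Vector ℤ d) → QuasiForestCondition f → AllPositive f
quasiForest⇒positive f (n , Δ , (Fs , order@((_ , facets) , _)) , ((F , F∈Δ , ∣F∣≡d) , bounded) , fΔ≡f) i
  with K , facet , F⊆K ← face⊆facet Δ F∈Δ
  with Cs , chain , Cs↭Fs ← leafChain Δ (Equivalence.from (facets K) facet) order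
  = subst (0ℤ ℤ.<_) (sym b≡β) (β-positive (toℕ i) chain
      (∈-resp-↭ (↭-sym Cs↭Fs) (Equivalence.from (facets K) facet))
      (ℕ.<-≤-trans (toℕ<n i) (ℕ.≤-trans (ℕ.≤-reflexive (sym ∣F∣≡d)) (p⊆q⇒∣p∣≤∣q∣ F⊆K))))
  where
  b≡β : bCoeff f (toℕ i) ≡ β (toℕ i) Cs
  b≡β = trans (bCoeff-fVector Δ f bounded fΔ≡f (toℕ i))
    (weight-cong (bWeight (toℕ i)) (face? Δ) ⟨ Cs ⟩? (Face≐⟨facets⟩ Δ λ H → mk⇔
      (Equivalence.to (facets H) ∘ ∈-resp-↭ Cs↭Fs)
      (∈-resp-↭ (↭-sym Cs↭Fs) ∘ Equivalence.from (facets H))))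

-- From forests to quasi-forests

∈-allSubsets : (S : Subset n) → S ∈ allSubsets n
∈-allSubsets Vec.[]              = here refl
∈-allSubsets (outside Vec.∷ S) = ∈-++⁺ˡ (∈-map⁺ (outside Vec.∷_) (∈-allSubsets S))
∈-allSubsets (inside  Vec.∷ S) = ∈-++⁺ʳ _ (∈-map⁺ (inside Vec.∷_) (∈-allSubsets S))

allSubsets-unique : ∀ n → Unique (allSubsets n)
allSubsets-unique zero    = All.[] AllPairs.∷ AllPairs.[]
allSubsets-unique (suc n) = Unique.++⁺
  (Unique.map⁺ Vec.∷-injectiveʳ (allSubsets-unique n))
  (Unique.map⁺ Vec.∷-injectiveʳ (allSubsets-unique n))
  disjoint
  where
  disjoint : ∀ {S} → ¬ (S ∈ List.map (outside Vec.∷_) (allSubsets n) × S ∈ List.map (inside Vec.∷_) (allSubsets n))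
  disjoint (S∈out , S∈in) with _ , _ , refl ← ∈-map⁻ (outside Vec.∷_) S∈out with ∈-map⁻ (inside Vec.∷_) S∈in
  ... | _ , _ , ()

-- Appending z leaves the earlier prefixes alone and adds only the full list as a new one. `P` is
-- arbitrary so that the induction can absorb the head into it.
prefixes-∷ʳ : ∀ {A : Set} (P : List A → A → Set) xs z →
  (∀ j → P (take (suc (toℕ j)) xs) (lookup xs j)) → P (xs ∷ʳ z) z →
  ∀ j → P (take (suc (toℕ j)) (xs ∷ʳ z)) (lookup (xs ∷ʳ z) j)
prefixes-∷ʳ P []       z Pxs Pz zero    = Pz
prefixes-∷ʳ P (y ∷ xs) z Pxs Pz zero    = Pxs zero
prefixes-∷ʳ P (y ∷ xs) z Pxs Pz (suc j) = prefixes-∷ʳ (P ∘ (y ∷_)) xs z (Pxs ∘ suc) Pz j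

-- Take a leaf of the whole subcomplex, arrange the remaining facets by induction, and put the leaf
-- last; permuting generators does not change the complex. The recursion is on the length `m`, as
-- `As ++ Bs` is not a structural part of `Fs`.
leaf-arrangement : (Δ : SimplicialComplex n) → IsForest Δ → ∀ m Fs → length Fs ≡ m →
  (∀ {F} → F ∈ Fs → IsFacet (Face Δ) F) →
  ∃[ Gs ] Gs ↭ Fs × (∀ j → IsLeaf ⟨ take (suc (toℕ j)) Gs ⟩ (lookup Gs j))
leaf-arrangement Δ forest zero    []         _     facets = [] , ↭-refl , λ ()
leaf-arrangement Δ forest (suc m) Fs@(_ ∷ _) ∣Fs∣≡ facets
  with F , leaf ← forest Fs (λ ()) (All.tabulate facets)
  with As , Bs , Fs≡ ← ∈-∃++ (facet⇒∈ (proj₁ leaf))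
  with Gs , Gs↭ , leaves ← leaf-arrangement Δ forest m (As ++ Bs)
         (ℕ.suc-injective (trans (sym (List.length-++-sucʳ As F Bs)) (trans (cong length (sym Fs≡)) ∣Fs∣≡)))
         (facets ∘ subst (_ ∈_) (sym Fs≡) ∘ ∈-resp-↭ (↭-sym (shift F As Bs)) ∘ there)
  = Gs ∷ʳ F , all↭ , prefixes-∷ʳ (λ Hs H → IsLeaf ⟨ Hs ⟩ H) Gs F leaves
      (IsLeaf-resp-≐ (Any-resp-↭ (↭-sym all↭) , Any-resp-↭ all↭) leaf)
  where
  all↭ : Gs ∷ʳ F ↭ Fs
  all↭ = ↭-trans (↭-sym (∷↭∷ʳ F Gs)) (↭-trans (prep F Gs↭)
           (subst (F ∷ As ++ Bs ↭_) (sym Fs≡) (↭-sym (shift F As Bs))))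

forest⇒quasiForest : (Δ : SimplicialComplex n) → IsForest Δ → IsQuasiForest Δ
forest⇒quasiForest {n} Δ forest with leaf-arrangement Δ forest _
    (List.filter (facet? Δ) (allSubsets n)) refl (proj₂ ∘ ∈-filter⁻ (facet? Δ) {xs = allSubsets n})
... | Gs , Gs↭ , leaves = Gs , (unique , facets) , λ j _ → leaves j
  where
  unique : Unique Gs
  unique = Unique-resp-↭ (setoid _) (↭⇒↭ₛ (↭-sym Gs↭)) (Unique.filter⁺ (facet? Δ) (allSubsets-unique n))
  facets : ∀ F → F ∈ Gs ⇔ IsFacet (Face Δ) F
  facets F = mk⇔ (λ F∈Gs → proj₂ (∈-filter⁻ (facet? Δ) {xs = allSubsets n} (∈-resp-↭ Gs↭ F∈Gs)))
                 (∈-resp-↭ (↭-sym Gs↭) ∘ ∈-filter⁺ (facet? Δ) (∈-allSubsets F))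

-- The forest with prescribed b

seg : ∀ d → ℕ → Subset d
seg zero    e       = Vec.[]
seg (suc d) zero    = outside Vec.∷ seg d zero
seg (suc d) (suc e) = inside Vec.∷ seg d e

seg-mono : ∀ {e e′} → e ℕ.≤ e′ → seg d e ⊆ seg d e′
seg-mono {zero}  e≤e′               = λ ()
seg-mono {suc d} {e′ = zero}  z≤n   = s⊆s (seg-mono {d} z≤n)
seg-mono {suc d} {e′ = suc _} z≤n   = out⊆ (seg-mono {d} z≤n)
seg-mono {suc d} (s≤s e≤e′)         = s⊆s (seg-mono {d} e≤e′)

∣seg∣ : ∀ {e} → e ℕ.≤ d → ∣ seg d e ∣ ≡ e
∣seg∣ {zero}  z≤n       = refl
∣seg∣ {suc d} z≤n       = ∣seg∣ {d} z≤n
∣seg∣ {suc d} (s≤s e≤d) = cong suc (∣seg∣ e≤d)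

∈seg-full : ∀ (v : Fin d) → v Subset.∈ seg d d
∈seg-full zero    = Vec.here
∈seg-full (suc v) = Vec.there (∈seg-full v)

module Star (d : ℕ) where

  core : ∀ m → ℕ → Subset (m ℕ.+ d)
  core zero    e = seg d e
  core (suc m) e = outside Vec.∷ core m e

  core-mono : ∀ m {e e′} → e ℕ.≤ e′ → core m e ⊆ core m e′
  core-mono zero    e≤e′ = seg-mono {d} e≤e′
  core-mono (suc m) e≤e′ = s⊆s (core-mono m e≤e′)

  ∣core∣ : ∀ m {e} → e ℕ.≤ d → ∣ core m e ∣ ≡ e
  ∣core∣ zero    e≤d = ∣seg∣ e≤d
  ∣core∣ (suc m) e≤d = ∣core∣ m e≤d

  -- Each e in es contributes a new vertex, attached to the first e core vertices;
  -- the core vertices come last in the vertex order.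
  star : (es : List (Fin d)) → List (Subset (length es ℕ.+ d))
  star []       = core 0 d ∷ []
  star (e ∷ es) = (inside Vec.∷ core (length es) (toℕ e)) ∷ List.map (outside Vec.∷_) (star es)

  core∈star : ∀ es → core (length es) d ∈ star es
  core∈star []       = here refl
  core∈star (e ∷ es) = there (∈-map⁺ (outside Vec.∷_) (core∈star es))

  vertex∈star : ∀ es v → ∃[ F ] F ∈ star es × v Subset.∈ F
  vertex∈star []       v       = core 0 d , here refl , ∈seg-full v
  vertex∈star (e ∷ es) zero    = _ , here refl , Vec.here
  vertex∈star (e ∷ es) (suc v) with F , F∈star , v∈F ← vertex∈star es v =
    outside Vec.∷ F , there (∈-map⁺ (outside Vec.∷_) F∈star) , Vec.there v∈F

  -- An attached facet consists of `toℕ e` core vertices and one new vertex, and `toℕ e` is less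
  -- than d.
  ∣star∣≤d : ∀ es {F} → F ∈ star es → ∣ F ∣ ℕ.≤ d
  ∣star∣≤d []       (here refl) = ℕ.≤-reflexive (∣core∣ 0 ℕ.≤-refl)
  ∣star∣≤d (e ∷ es) (here refl) =
    subst (ℕ._< d) (sym (∣core∣ (length es) (ℕ.<⇒≤ (toℕ<n e)))) (toℕ<n e)
  ∣star∣≤d (e ∷ es) (there F∈) with F , F∈star , refl ← ∈-map⁻ (outside Vec.∷_) F∈ = ∣star∣≤d es F∈star

  -- For e at most d this means that F meets the core exactly in its first e vertices. The two
  -- inclusions are kept apart because a branch needs the first and the facets compared with it need
  -- the second.
  Trace : ∀ m → Subset (m ℕ.+ d) → ℕ → Set
  Trace m F e = core m e ⊆ F × F ∩ core m d ⊆ core m e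

  trace : ∀ es {F} → F ∈ star es → ∃[ e ] Trace (length es) F e
  trace []       (here refl) = d , ⊆-refl , p∩q⊆p (core 0 d) (core 0 d)
  trace (e ∷ es) (here refl) =
    toℕ e , out⊆ ⊆-refl , s⊆s (p∩q⊆p (core (length es) (toℕ e)) (core (length es) d))
  trace (e ∷ es) (there F∈)
    with F , F∈star , refl ← ∈-map⁻ (outside Vec.∷_) F∈
    with e′ , core⊆F , F∩core⊆ ← trace es F∈star = e′ , s⊆s core⊆F , s⊆s F∩core⊆

  -- Each attached vertex belongs to a single facet, so distinct facets share core vertices only.
  star-∩ : ∀ es {F H} → F ∈ star es → H ∈ star es → F ≢ H → F ∩ H ⊆ core (length es) d
  star-∩ []       (here refl) (here refl) F≢H = contradiction refl F≢H
  star-∩ (e ∷ es) (here refl) (here refl) F≢H = contradiction refl F≢H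
  star-∩ (e ∷ es) (here refl) (there H∈)  F≢H
    with H , H∈star , refl ← ∈-map⁻ (outside Vec.∷_) H∈ =
    s⊆s (⊆-trans (p∩q⊆p _ H) (core-mono (length es) (ℕ.<⇒≤ (toℕ<n e))))
  star-∩ (e ∷ es) (there F∈)  (here refl) F≢H
    with F , F∈star , refl ← ∈-map⁻ (outside Vec.∷_) F∈ =
    s⊆s (⊆-trans (p∩q⊆q F _) (core-mono (length es) (ℕ.<⇒≤ (toℕ<n e))))
  star-∩ (e ∷ es) (there F∈)  (there H∈)  F≢H
    with F , F∈star , refl ← ∈-map⁻ (outside Vec.∷_) F∈
    with H , H∈star , refl ← ∈-map⁻ (outside Vec.∷_) H∈ =
    s⊆s (star-∩ es F∈star H∈star (F≢H ∘ cong (outside Vec.∷_)))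

  starComplex : (es : List (Fin d)) → SimplicialComplex (length es ℕ.+ d)
  starComplex es .Face  = ⟨ star es ⟩
  starComplex es .face? = ⟨ star es ⟩?
  starComplex es .vertex v with F , F∈star , v∈F ← vertex∈star es v =
    lose F∈star λ u∈⁅v⁆ → subst (Subset._∈ F) (sym (x∈⁅y⁆⇒x≡y v u∈⁅v⁆)) v∈F
  starComplex es .downClosed {F} {G} G⊆F = Any.map {P = F ⊆_} {Q = G ⊆_} (λ F⊆H → ⊆-trans G⊆F F⊆H)

  starComplex-maxFaceSize : ∀ es → IsMaxFaceSize (starComplex es) d
  starComplex-maxFaceSize es =
    (core (length es) d , lose (core∈star es) ⊆-refl , ∣core∣ (length es) ℕ.≤-refl) , bounded
    where
    bounded : ∀ F → ⟨ star es ⟩ F → ∣ F ∣ ℕ.≤ d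
    bounded F F∈⟨star⟩ with H , H∈star , F⊆H ← find F∈⟨star⟩ =
      ℕ.≤-trans (p⊆q⇒∣p∣≤∣q∣ F⊆H) (∣star∣≤d es H∈star)

  -- Traces on the core are initial segments, hence totally ordered by inclusion; G is a member
  -- whose trace is largest.
  maximal-trace : ∀ m F Fs → (∀ {H} → H ∈ F ∷ Fs → ∃[ e ] Trace m H e) →
    ∃[ G ] ∃[ e ] G ∈ F ∷ Fs × core m e ⊆ G × (∀ {H} → H ∈ F ∷ Fs → H ∩ core m d ⊆ core m e)
  maximal-trace m F []       traces with e , core⊆F , F∩core⊆ ← traces (here refl) =
    F , e , here refl , core⊆F , λ where (here refl) → F∩core⊆
  maximal-trace m F (F′ ∷ Fs) traces
    with e , core⊆F , F∩core⊆ ← traces (here refl)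
    with G , e′ , G∈ , core⊆G , covers ← maximal-trace m F′ Fs (traces ∘ there)
    with ℕ.≤-total e e′
  ... | inj₁ e≤e′ = G , e′ , there G∈ , core⊆G , λ where
    (here refl) → ⊆-trans F∩core⊆ (core-mono m e≤e′)
    (there H∈)  → covers H∈
  ... | inj₂ e′≤e = F , e , here refl , core⊆F , λ where
    (here refl) → F∩core⊆
    (there H∈)  → ⊆-trans (covers H∈) (core-mono m e′≤e)

  -- Any member of the list is a leaf, so the first is taken. Its branch is a facet with the largest
  -- trace among the others, because other facets meet F only inside the core.
  starComplex-forest : ∀ es → IsForest (starComplex es)
  starComplex-forest es []           Fs≢[] _         = contradiction refl Fs≢[]
  starComplex-forest es Fs@(F ∷ Fs′) _     allFacets =
    F , ∈⇒facet (starComplex es) facets (here refl) , leaf (List.filter others? Fs) refl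
    where
    m = length es

    -- The list may repeat F, so the other facets are selected by inequality with F and may be
    -- absent even if `Fs′` is nonempty.
    others? = λ H → ¬? (H ≟ₛ F)

    facets : ∀ {H} → H ∈ Fs → IsFacet ⟨ star es ⟩ H
    facets = All.lookup allFacets

    other∈star : ∀ {H} → H ∈ List.filter others? Fs → H ∈ star es
    other∈star H∈ = facet⇒∈ (facets (proj₁ (∈-filter⁻ others? {xs = Fs} H∈)))

    leaf : ∀ Hs → List.filter others? Fs ≡ Hs →
      (∀ H → IsFacet ⟨ Fs ⟩ H → H ≡ F) ⊎ (∃[ G ] IsBranch ⟨ Fs ⟩ F G)
    leaf [] none = inj₁ unique
      where
      unique : ∀ H → IsFacet ⟨ Fs ⟩ H → H ≡ F
      unique H facetH with H ≟ₛ F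
      ... | yes H≡F = H≡F
      ... | no  H≢F with subst (H ∈_) none (∈-filter⁺ others? (facet⇒∈ facetH) H≢F)
      ...   | ()
    leaf (H₀ ∷ Hs) others≡
      with G , e , G∈ , core⊆G , covers ← maximal-trace m H₀ Hs
             (trace es ∘ other∈star ∘ subst (_ ∈_) (sym others≡))
      with G∈Fs , G≢F ← ∈-filter⁻ others? {xs = Fs} (subst (G ∈_) (sym others≡) G∈)
      = inj₂ (G , ∈⇒facet (starComplex es) facets G∈Fs , G≢F , branch)
      where
      branch : ∀ H → IsFacet ⟨ Fs ⟩ H → H ≢ F → H ∩ F ⊆ G ∩ F
      -- A common vertex of H and F lies in the core, hence in the trace of H, hence in the largest
      -- trace, which G contains.
      branch H facetH H≢F {v} v∈H∩F = x∈p∩q⁺ (core⊆G (covers H∈others v∈H∩core) , p∩q⊆q H F v∈H∩F)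
        where
        H∈Fs : H ∈ Fs
        H∈Fs = facet⇒∈ facetH
        H∈others : H ∈ H₀ ∷ Hs
        H∈others = subst (H ∈_) others≡ (∈-filter⁺ others? H∈Fs H≢F)
        v∈H∩core : v Subset.∈ H ∩ core m d
        v∈H∩core = x∈p∩q⁺ (p∩q⊆p H F v∈H∩F ,
          star-∩ es (facet⇒∈ (facets H∈Fs)) (facet⇒∈ (facets (here refl))) H≢F v∈H∩F)

  occurrences : ℕ → List (Fin d) → ℤ
  occurrences k []       = 0ℤ
  occurrences k (e ∷ es) = δ (toℕ e) k + occurrences k es

  -- The core simplex contributes 1 for each k below d. A vertex attached to the first e core
  -- vertices gives a facet of size e + 1 meeting the rest in e vertices, so it adds 1 exactly at k
  -- = e.
  β-star : ∀ k es → β k (star es) ≡ χ k d + occurrences k es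
  β-star k []       = trans (trans (β-[-] k (core 0 d)) (cong (χ k) (∣core∣ 0 ℕ.≤-refl))) (sym (ℤ.+-identityʳ _))
  β-star k (e ∷ es) = begin
    β k (star (e ∷ es))
      -- The full core serves as branch: every earlier facet meets F inside it.
      ≡⟨ β-∷ k {F = F} (∈-map⁺ (outside Vec.∷_) (core∈star es)) H∩F⊆core ⟩
    β k (List.map (outside Vec.∷_) (star es)) + (χ k ∣ F ∣ - χ k ∣ core m (toℕ e) ∩ core m d ∣)
      ≡⟨ cong₂ (λ a b → a + (χ k ∣ F ∣ - χ k ∣ b ∣)) (β-map-outside k (star es)) core∩core ⟩
    β k (star es) + (χ k (suc ∣ core m (toℕ e) ∣) - χ k ∣ core m (toℕ e) ∣)
      ≡⟨ cong (λ a → β k (star es) + (χ k (suc a) - χ k a)) (∣core∣ m (ℕ.<⇒≤ (toℕ<n e))) ⟩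
    β k (star es) + (χ k (suc (toℕ e)) - χ k (toℕ e))
      ≡⟨ cong₂ (λ a b → a + (b - χ k (toℕ e))) (β-star k es) (χ-suc k (toℕ e)) ⟩
    χ k d + occurrences k es + (χ k (toℕ e) + δ (toℕ e) k - χ k (toℕ e))
      ≡⟨ rearrange (χ k d) (occurrences k es) (χ k (toℕ e)) (δ (toℕ e) k) ⟩
    χ k d + (δ (toℕ e) k + occurrences k es)
      ∎
    where
    m = length es

    F : Subset (suc m ℕ.+ d)
    F = inside Vec.∷ core m (toℕ e)

    core⊆core : core m (toℕ e) ⊆ core m d
    core⊆core = core-mono m (ℕ.<⇒≤ (toℕ<n e))

    core∩core : core m (toℕ e) ∩ core m d ≡ core m (toℕ e)
    core∩core = ⊆-antisym (p∩q⊆p (core m (toℕ e)) (core m d)) (λ v∈ → x∈p∩q⁺ (v∈ , core⊆core v∈))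

    H∩F⊆core : ∀ {H} → H ∈ List.map (outside Vec.∷_) (star es) → H ∩ F ⊆ core (suc m) d
    H∩F⊆core H∈ with H , _ , refl ← ∈-map⁻ (outside Vec.∷_) H∈ =
      s⊆s (⊆-trans (p∩q⊆q H (core m (toℕ e))) core⊆core)

    rearrange : ∀ a b c d → a + b + (c + d - c) ≡ a + (d + b)
    rearrange = solve-∀

  occurrences-++ : ∀ k es es′ → occurrences k (es ++ es′) ≡ occurrences k es + occurrences k es′
  occurrences-++ k []       es′ = sym (ℤ.+-identityˡ _)
  occurrences-++ k (e ∷ es) es′ = trans (cong (δ (toℕ e) k +_) (occurrences-++ k es es′)) (sym (ℤ.+-assoc (δ (toℕ e) k) _ _))

  occurrences-replicate : ∀ k m e → occurrences k (List.replicate m e) ≡ ℤ.+ m * δ (toℕ e) k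
  occurrences-replicate k zero    e = sym (ℤ.*-zeroˡ (δ (toℕ e) k))
  occurrences-replicate k (suc m) e = trans (cong (δ (toℕ e) k +_) (occurrences-replicate k m e))
    (sym (ℤ.suc-* (ℤ.+ m) (δ (toℕ e) k)))

  occurrences-concat : ∀ k {m} (g : Fin m → List (Fin d)) →
    occurrences k (List.concat (List.tabulate g)) ≡ sum (λ i → occurrences k (g i))
  occurrences-concat k {zero}  g = refl
  occurrences-concat k {suc m} g = trans (occurrences-++ k (g zero) _)
    (cong (occurrences k (g zero) +_) (occurrences-concat k (g ∘ suc)))

  multiset : (Fin d → ℕ) → List (Fin d)
  multiset a = List.concat (List.tabulate λ i → List.replicate (a i) i)

  occurrences-multiset : ∀ a i → occurrences (toℕ i) (multiset a) ≡ ℤ.+ a i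
  occurrences-multiset a i = begin
    occurrences (toℕ i) (multiset a)
      ≡⟨ occurrences-concat (toℕ i) (λ j → List.replicate (a j) j) ⟩
    sum (λ j → occurrences (toℕ i) (List.replicate (a j) j))
      ≡⟨ sum-cong-≗ (λ j → occurrences-replicate (toℕ i) (a j) j) ⟩
    sum (λ j → ℤ.+ a j * δ (toℕ j) (toℕ i))
      ≡⟨ sum-δ (λ j → ℤ.+ a j) i ⟩
    ℤ.+ a i
      ∎

-- The star complex is built to have the same b's as `f`; since the b's determine the vector, its
-- f-vector is `f`.
positive⇒ForestCondition : (f : Vector ℤ d) → AllPositive f → ForestCondition f
positive⇒ForestCondition {d} f 0<b =
  length es ℕ.+ d , Δ , starComplex-forest es , starComplex-maxFaceSize es , bCoeff-injective fΔ f agree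
  where
  open Star d

  -- The core already provides 1 at each index, so one less than the prescribed value is attached;
  -- positivity makes the predecessor exact.
  es = multiset λ i → ℕ.pred ℤ.∣ bCoeff f (toℕ i) ∣

  Δ = starComplex es

  fΔ : Vector ℤ d
  fΔ i = ℤ.+ fEntry Δ (toℕ i)

  1+pred : ∀ {q} → 0ℤ ℤ.< q → 1ℤ + ℤ.+ ℕ.pred ℤ.∣ q ∣ ≡ q
  1+pred {ℤ.+ suc q} _ = refl
  1+pred {ℤ.+ zero} (ℤ.+<+ ())

  agree-below-d : ∀ i → bCoeff fΔ (toℕ i) ≡ bCoeff f (toℕ i)
  agree-below-d i = begin
    bCoeff fΔ (toℕ i)
      ≡⟨ bCoeff-fVector Δ fΔ (proj₂ (starComplex-maxFaceSize es)) (λ _ → refl) (toℕ i) ⟩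
    β (toℕ i) (star es)
      ≡⟨ β-star (toℕ i) es ⟩
    χ (toℕ i) d + occurrences (toℕ i) es
      ≡⟨ cong₂ _+_ (χ-< (toℕ<n i)) (occurrences-multiset _ i) ⟩
    1ℤ + ℤ.+ ℕ.pred ℤ.∣ bCoeff f (toℕ i) ∣
      ≡⟨ 1+pred (0<b i) ⟩
    bCoeff f (toℕ i)
      ∎

  agree : ∀ k → bCoeff fΔ k ≡ bCoeff f k
  agree k with k ℕ.<? d
  ... | yes k<d = subst (λ k → bCoeff fΔ k ≡ bCoeff f k) (toℕ-fromℕ< k<d) (agree-below-d (fromℕ< k<d))
  ... | no  k≮d = trans (bCoeff-out fΔ (ℕ.≮⇒≥ k≮d)) (sym (bCoeff-out f (ℕ.≮⇒≥ k≮d)))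

-- Assembling the equivalences

forest⇒quasiForestCondition : ∀ {f : Vector ℤ d} → ForestCondition f → QuasiForestCondition f
forest⇒quasiForestCondition (n , Δ , forest , rest) = n , Δ , forest⇒quasiForest Δ forest , rest

theorem1p1 : (d : ℕ) → 1 ℕ.≤ d → (f : Vector ℤ d) → (∀ i → 0ℤ ℤ.< f i) →
    (QuasiForestCondition f ⇔ ForestCondition f) ×
    (QuasiForestCondition f ⇔ CCondition f) ×
    (QuasiForestCondition f ⇔ BCondition f)
theorem1p1 d _ f _ =
  -- All implications pass through positivity of the b's: a quasi-forest yields it, and it yields a
  -- forest, which is again a quasi-forest.
  mk⇔ (positive⇒ForestCondition f ∘ quasiForest⇒positive f) forest⇒quasiForestCondition ,
  mk⇔ (positive⇒CCondition f ∘ quasiForest⇒positive f) (positive⇒QuasiForestCondition ∘ CCondition⇒positive f) ,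
  mk⇔ (positive⇒BCondition f ∘ quasiForest⇒positive f) (positive⇒QuasiForestCondition ∘ BCondition⇒positive f)
  where
  positive⇒QuasiForestCondition : AllPositive f → QuasiForestCondition f
  positive⇒QuasiForestCondition = forest⇒quasiForestCondition ∘ positive⇒ForestCondition f
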